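{- Let $R$ be a flat term rewrite system over a signature $\mathcal{F}$ with set of constants $\mathcal{F}_0$. If there is a witness to non-$UN^=$ for $R$, then there exists a witness $\langle N_0,N_1\rangle$ to non-$UN^=$ for $R$ with $\mathrm{height}(N_0),\mathrm{height}(N_1)\le k=\max\{1,|\mathcal{F}_0|\}$. Hence $UN^=$ is decidable for flat term rewrite systems: there is an algorithm which, given a flat term rewrite system $R$, decides whether $R$ is $UN^=$.
   Context: Terms are built from a finite signature $\mathcal{F}$ (function symbols with arities; $\mathcal{F}_0$ is the set of constants, i.e. arity-$0$ symbols) and a countably infinite set $X$ of variables disjoint from $\mathcal{F}$. The height of a constant or variable is $0$, and $\mathrm{height}(f(t_1,\dots,t_n))=1+\max_i \mathrm{height}(t_i)$ for $n>0$. A term is flat if its height is $0$ or $1$. A rewrite rule is a pair $l\to r$ of terms with $l\notin X$ (variables of $r$ need not occur in $l$); it applies to a term by replacing a subterm of the form $l\sigma$ by $r\sigma$, $\sigma$ a substitution. A term rewrite system (TRS) $R$ is a finite set of rules; it is flat if both sides of every rule are flat. $\overset{*}{\leftrightarrow}_R$ denotes the reflexive, symmetric, transitive closure of the one-step rewrite relation. A normal form is a term none of whose subterms can be rewritten. $R$ is $UN^=$ if there do not exist two distinct normal forms $M,N$ (terms possibly containing variables) with $M\overset{*}{\leftrightarrow}_R N$; such a pair $\langle M,N\rangle$ is called a witness to non-$UN^=$. -}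

module Defs where

open import Data.Fin.Base using (Fin)
open import Data.List.Base using (List; length; filter; allFin)
open import Data.List.Membership.Propositional using (_∈_)
open import Data.List.Relation.Unary.All using (All)
open import Data.Nat.Base using (ℕ; suc; _⊔_; _≤_)
open import Data.Nat.Properties using (_≟_)
open import Data.Product.Base using (_×_; ∃₂)
open import Data.Vec.Base using (Vec; []; _∷_; lookup; _[_]≔_)
open import Relation.Binary.Construct.Closure.Equivalence using (EqClosure)
open import Relation.Binary.PropositionalEquality.Core using (_≢_)
open import Relation.Binary.Rewriting using (IsNormalForm)
open import Relation.Nullary.Negation.Core using (¬_)

record Signature : Set where
  field
    size  : ℕ
    arity : Fin size → ℕ

  Symbol : Set
  Symbol = Fin size

  constants : List Symbol
  constants = filter (λ f → arity f ≟ 0) (allFin size)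

open Signature public

Variable : Set
Variable = ℕ

data Term (F : Signature) : Set where
  var : Variable → Term F
  op  : (f : Symbol F) → Vec (Term F) (arity F f) → Term F

module _ {F : Signature} where

  -- heightArgs ts is the height of a symbol applied to ts, so it is 0 when
  -- the symbol is a constant; the value maxHeight [] = 0 is only the neutral
  -- element of the maximum.
  height     : Term F → ℕ
  heightArgs : ∀ {n} → Vec (Term F) n → ℕ
  maxHeight  : ∀ {n} → Vec (Term F) n → ℕ

  height (var x)   = 0
  height (op f ts) = heightArgs ts

  heightArgs []       = 0
  heightArgs (t ∷ ts) = suc (height t ⊔ maxHeight ts)

  maxHeight []       = 0
  maxHeight (t ∷ ts) = height t ⊔ maxHeight ts

  FlatTerm : Term F → Set
  FlatTerm t = height t ≤ 1

Substitution : Signature → Set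
Substitution F = Variable → Term F

module _ {F : Signature} where

  infixl 8 _⟨_⟩ _⟨_⟩*

  _⟨_⟩  : Term F → Substitution F → Term F
  _⟨_⟩* : ∀ {n} → Vec (Term F) n → Substitution F → Vec (Term F) n

  var x   ⟨ σ ⟩ = σ x
  op f ts ⟨ σ ⟩ = op f (ts ⟨ σ ⟩*)

  []       ⟨ σ ⟩* = []
  (t ∷ ts) ⟨ σ ⟩* = t ⟨ σ ⟩ ∷ ts ⟨ σ ⟩*

record Rule (F : Signature) : Set where
  field
    lhs     : Term F
    rhs     : Term F
    lhs≢var : ∀ x → lhs ≢ var x

open Rule public

TRS : Signature → Set
TRS F = List (Rule F)

module _ {F : Signature} where

  FlatRule : Rule F → Set
  FlatRule ρ = FlatTerm (lhs ρ) × FlatTerm (rhs ρ)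

  Flat : TRS F → Set
  Flat R = All FlatRule R

  infix 4 _⊢_⟶_ _⊢_↔*_

  data _⊢_⟶_ (R : TRS F) : Term F → Term F → Set where
    root : ∀ {ρ} → ρ ∈ R → (σ : Substitution F) →
           R ⊢ lhs ρ ⟨ σ ⟩ ⟶ rhs ρ ⟨ σ ⟩
    arg  : ∀ {f} (ts : Vec (Term F) (arity F f)) i {u} →
           R ⊢ lookup ts i ⟶ u →
           R ⊢ op f ts ⟶ op f (ts [ i ]≔ u)

  _⊢_↔*_ : TRS F → Term F → Term F → Set
  R ⊢ M ↔* N = EqClosure (R ⊢_⟶_) M N

  -- Since ⟶ is closed under contexts, IsNormalForm says that no subterm can
  -- be rewritten.
  record Witness (R : TRS F) (M N : Term F) : Set where
    field
      normalˡ    : IsNormalForm (R ⊢_⟶_) M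
      normalʳ    : IsNormalForm (R ⊢_⟶_) N
      distinct   : M ≢ N
      equivalent : R ⊢ M ↔* N

  -- The library's UniqueNormalForm is the positive form of this property.
  UN⁼ : TRS F → Set
  UN⁼ R = ¬ ∃₂ (Witness R)

bound : Signature → ℕ
bound F = 1 ⊔ length (constants F)

{-# OPTIONS --safe #-}

-- Call a flat term over "atoms" (constants and variables) a shape, and let _~_
-- be the equivalence on shapes generated by the rules whose variables are
-- instantiated by atoms only.  It lives on finitely many shapes up to renaming,
-- so it is decidable by saturation.  Assign normal forms to constants
-- greedily: as long as some class of constants with no term assigned contains
-- a shape that becomes normal when its constants are replaced by their assigned
-- normal forms, use that term.  If it contains a variable, renaming this
-- variable gives a witness; otherwise the n-th assigned term has height < n.
-- Then compare the normal instances of equivalent shapes: two distinct ones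
-- are a witness of the required height.  If there are none, the assignment and
-- the uniqueness just checked define a model of R on terms: a symbol applied to
-- values is an atom if its shape is equivalent to one, else the normal shape in
-- its class, else a junk element.  A normal form can be read back from its value
-- in the model, so no two distinct normal forms are convertible.
module Submission where

open import Defs
open import Data.Empty using (⊥)
open import Data.Fin.Base using (Fin; zero; suc; toℕ; fromℕ<)
open import Data.Fin.Properties using (toℕ<n; toℕ-fromℕ<; fromℕ<-toℕ) renaming (_≟_ to _≟F_; all? to allFin?)
open import Data.List.Base as List
  using (List; []; _∷_; _++_; length; filter; allFin; cartesianProductWith; cartesianProduct; concatMap; upTo)
open import Data.List.Membership.Propositional using (_∈_; lose; find)
open import Data.List.Membership.Propositional.Properties
  using (∈-++⁺ˡ; ∈-++⁺ʳ; ∈-++⁻; ∈-filter⁺; ∈-filter⁻; ∈-lookup; ∈-allFin; ∈-map⁺; ∈-map⁻; ∈-concatMap⁺;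
         ∈-cartesianProductWith⁺; ∈-cartesianProduct⁺; ∈-upTo⁺)
open import Data.List.Properties using (length-filter; length-tabulate; length-++; map-++; filter-≐)
open import Data.List.Relation.Unary.All as All using (All; []; _∷_)
open import Data.List.Relation.Unary.Any as Any using (Any; here; there; any?)
open import Data.List.Relation.Unary.Any.Properties using (lookup-index)
open import Data.Maybe.Base using (Maybe; just; nothing; maybe′)
import Data.Maybe.Properties as Maybe
open import Data.Nat.Base using (ℕ; zero; suc; pred; _+_; _∸_; _⊔_; _≤_; _<_; z≤n; s≤s)
open import Data.Nat.Properties as ℕ using (_≟_)
open import Data.List.Extrema ℕ.≤-totalOrder using (max; xs≤max)
open import Data.Product.Base using (_×_; _,_; ∃; ∃₂; Σ; proj₁; proj₂)
open import Data.Product.Properties using (≡-dec)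
open import Data.Sum.Base using (_⊎_; inj₁; inj₂; [_,_]′)
open import Data.Vec.Base as Vec using (Vec; []; _∷_; lookup; _[_]≔_)
import Data.Vec.Properties as Vec
open import Function.Base using (_∘_; id)
open import Relation.Binary.Construct.Closure.Equivalence as Eq using ()
open import Relation.Binary.Construct.Closure.ReflexiveTransitive using (ε; _◅_; _◅◅_)
open import Relation.Binary.Construct.Closure.Symmetric using (fwd; bwd)
open import Relation.Binary.Definitions using (DecidableEquality)
open import Relation.Binary.PropositionalEquality
  using (_≡_; _≢_; refl; sym; trans; cong; cong₂; subst; subst₂)
open import Relation.Binary.Rewriting using (IsNormalForm)
open import Relation.Nullary.Decidable using (Dec; yes; no; _×-dec_; _⊎-dec_; ¬?; map′)
open import Relation.Nullary.Negation using (¬_; contradiction)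

-- Bounded ascent, finite enumerations and finite maps

ascend : {S G : Set} (μ : S → ℕ) (b : ℕ) → (∀ s → μ s ≤ b) →
         (∀ s → G ⊎ ∃ λ s′ → μ s < μ s′) → S → G
ascend {S} {G} μ b μ≤b step s₀ = go b s₀ (ℕ.m≤m+n b (μ s₀))
  where
  -- The fuel `n` bounds how far `μ` can still rise, so `step` must succeed by the time it is zero.
  go : ∀ n s → b ≤ n + μ s → G
  go n s b≤ with step s
  ... | inj₁ g = g
  go zero s b≤ | inj₂ (s′ , lt) = contradiction (ℕ.≤-trans lt (ℕ.≤-trans (μ≤b s′) b≤)) (ℕ.<-irrefl refl)
  go (suc n) s b≤ | inj₂ (s′ , lt) =
    go n s′ (ℕ.≤-trans b≤ (ℕ.≤-trans (ℕ.≤-reflexive (sym (ℕ.+-suc n (μ s)))) (ℕ.+-monoʳ-≤ n lt)))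

module _ {A : Set} {P Q : A → Set} (P? : ∀ x → Dec (P x)) (Q? : ∀ x → Dec (Q x))
         (P⊆Q : ∀ {x} → P x → Q x) where

  length-filter-mono : ∀ xs → length (filter P? xs) ≤ length (filter Q? xs)
  length-filter-mono [] = z≤n
  length-filter-mono (x ∷ xs) with P? x | Q? x
  ... | yes _ | yes _ = s≤s (length-filter-mono xs)
  ... | yes p | no ¬q = contradiction (P⊆Q p) ¬q
  ... | no  _ | yes _ = ℕ.m≤n⇒m≤1+n (length-filter-mono xs)
  ... | no  _ | no  _ = length-filter-mono xs

  length-filter-strict : ∀ {x xs} → x ∈ xs → ¬ P x → Q x →
                         length (filter P? xs) < length (filter Q? xs)
  length-filter-strict {xs = y ∷ ys} (here refl) ¬p q with P? y | Q? y
  ... | yes p | _     = contradiction p ¬p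
  ... | no  _ | yes _ = s≤s (length-filter-mono ys)
  ... | no  _ | no ¬q = contradiction q ¬q
  length-filter-strict {xs = y ∷ ys} (there x∈) ¬p q with P? y | Q? y
  ... | yes _ | yes _ = s≤s (length-filter-strict x∈ ¬p q)
  ... | yes p | no ¬q = contradiction (P⊆Q p) ¬q
  ... | no  _ | yes _ = ℕ.m≤n⇒m≤1+n (length-filter-strict x∈ ¬p q)
  ... | no  _ | no  _ = length-filter-strict x∈ ¬p q

vectors : {A : Set} → List A → ∀ n → List (Vec A n)
vectors xs zero    = [] ∷ []
vectors xs (suc n) = cartesianProductWith _∷_ xs (vectors xs n)

∈-vectors : {A : Set} {xs : List A} → ∀ {n} (v : Vec A n) → (∀ i → lookup v i ∈ xs) → v ∈ vectors xs n
∈-vectors []      v⊆ = here refl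
∈-vectors (a ∷ v) v⊆ = ∈-cartesianProductWith⁺ _∷_ (v⊆ zero) (∈-vectors v (v⊆ ∘ suc))

vec-ext : {A : Set} → ∀ {n} {u v : Vec A n} → (∀ i → lookup u i ≡ lookup v i) → u ≡ v
vec-ext {u = []}    {[]}    eq = refl
vec-ext {u = _ ∷ _} {_ ∷ _} eq = cong₂ _∷_ (eq zero) (vec-ext (eq ∘ suc))

empty : {A : Set} → ∀ {n} → n ≡ 0 → Vec A n
empty refl = []

empty-unique : {A : Set} → ∀ {n} (p : n ≡ 0) (v : Vec A n) → v ≡ empty p
empty-unique refl [] = refl

look : {A : Set} → A → List (ℕ × A) → ℕ → A
look d []             x = d
look d ((y , a) ∷ ps) x with x ≟ y
... | yes _ = a
... | no  _ = look d ps x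

-- Repetitions in `xs` do no harm: all pairs with key `x` carry the same value.
look-graph : {A : Set} (d : A) (σ : ℕ → A) → ∀ {x xs} → x ∈ xs →
             look d (List.map (λ y → y , σ y) xs) x ≡ σ x
look-graph d σ {x} {y ∷ xs} x∈ with x ≟ y
look-graph d σ x∈          | yes refl = refl
look-graph d σ (here eq)   | no x≢y   = contradiction eq x≢y
look-graph d σ (there x∈)  | no x≢y   = look-graph d σ x∈

-- Matching

module _ {F : Signature} where

  infix 4 _≟T_ _≟T*_

  _≟T_  : DecidableEquality (Term F)
  _≟T*_ : ∀ {n} → DecidableEquality (Vec (Term F) n)

  var x   ≟T var y   = map′ (cong var) (λ { refl → refl }) (x ≟ y)
  var x   ≟T op g us = no λ ()
  op f ts ≟T var y   = no λ ()
  op f ts ≟T op g us with f ≟F g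
  ... | no f≢g   = no λ { refl → f≢g refl }
  ... | yes refl = map′ (cong (op f)) (λ { refl → refl }) (ts ≟T* us)

  []       ≟T* []       = yes refl
  (t ∷ ts) ≟T* (u ∷ us) = map′ (λ { (refl , refl) → refl }) (λ { refl → refl , refl }) (t ≟T u ×-dec ts ≟T* us)

  ⟨⟩*-map : ∀ {n} (ts : Vec (Term F) n) σ → ts ⟨ σ ⟩* ≡ Vec.map (_⟨ σ ⟩) ts
  ⟨⟩*-map []       σ = refl
  ⟨⟩*-map (t ∷ ts) σ = cong (_ ∷_) (⟨⟩*-map ts σ)

  ⟨⟩-⟨⟩  : ∀ (t : Term F) σ τ → t ⟨ σ ⟩ ⟨ τ ⟩ ≡ t ⟨ (λ x → σ x ⟨ τ ⟩) ⟩
  ⟨⟩*-⟨⟩* : ∀ {n} (ts : Vec (Term F) n) σ τ → ts ⟨ σ ⟩* ⟨ τ ⟩* ≡ ts ⟨ (λ x → σ x ⟨ τ ⟩) ⟩*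
  ⟨⟩-⟨⟩ (var x)   σ τ = refl
  ⟨⟩-⟨⟩ (op f ts) σ τ = cong (op f) (⟨⟩*-⟨⟩* ts σ τ)
  ⟨⟩*-⟨⟩* []       σ τ = refl
  ⟨⟩*-⟨⟩* (t ∷ ts) σ τ = cong₂ _∷_ (⟨⟩-⟨⟩ t σ τ) (⟨⟩*-⟨⟩* ts σ τ)

  lookup-⟨⟩* : ∀ {n} (ts : Vec (Term F) n) σ i → lookup (ts ⟨ σ ⟩*) i ≡ lookup ts i ⟨ σ ⟩
  lookup-⟨⟩* (t ∷ ts) σ zero    = refl
  lookup-⟨⟩* (t ∷ ts) σ (suc i) = lookup-⟨⟩* ts σ i

  update-⟨⟩* : ∀ {n} (ts : Vec (Term F) n) σ i u → (ts [ i ]≔ u) ⟨ σ ⟩* ≡ ts ⟨ σ ⟩* [ i ]≔ u ⟨ σ ⟩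
  update-⟨⟩* (t ∷ ts) σ zero    u = refl
  update-⟨⟩* (t ∷ ts) σ (suc i) u = cong (_ ∷_) (update-⟨⟩* ts σ i u)

  vars  : Term F → List Variable
  vars* : ∀ {n} → Vec (Term F) n → List Variable
  vars (var x)    = x ∷ []
  vars (op f ts)  = vars* ts
  vars* []        = []
  vars* (t ∷ ts)  = vars t ++ vars* ts

  ⟨⟩-cong  : ∀ (t : Term F) {σ τ} → (∀ {x} → x ∈ vars t → σ x ≡ τ x) → t ⟨ σ ⟩ ≡ t ⟨ τ ⟩
  ⟨⟩*-cong : ∀ {n} (ts : Vec (Term F) n) {σ τ} → (∀ {x} → x ∈ vars* ts → σ x ≡ τ x) → ts ⟨ σ ⟩* ≡ ts ⟨ τ ⟩*
  ⟨⟩-cong (var x)   eq = eq (here refl)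
  ⟨⟩-cong (op f ts) eq = cong (op f) (⟨⟩*-cong ts eq)
  ⟨⟩*-cong []       eq = refl
  ⟨⟩*-cong (t ∷ ts) eq = cong₂ _∷_ (⟨⟩-cong t (eq ∘ ∈-++⁺ˡ)) (⟨⟩*-cong ts (eq ∘ ∈-++⁺ʳ (vars t)))

  -- Terms of different form just cut the list short; whoever uses the bindings tests the
  -- substitution they define.
  bindings  : Term F → Term F → List (Variable × Term F)
  bindings* : ∀ {n m} → Vec (Term F) n → Vec (Term F) m → List (Variable × Term F)
  bindings (var x)   u         = (x , u) ∷ []
  bindings (op f ts) (var x)   = []
  bindings (op f ts) (op g us) = bindings* ts us
  bindings* (t ∷ ts) (u ∷ us)  = bindings t u ++ bindings* ts us
  bindings* _        _         = []

  bindings-⟨⟩ : ∀ (t : Term F) σ → bindings t (t ⟨ σ ⟩) ≡ List.map (λ x → x , σ x) (vars t)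
  bindings-⟨⟩* : ∀ {n} (ts : Vec (Term F) n) σ → bindings* ts (ts ⟨ σ ⟩*) ≡ List.map (λ x → x , σ x) (vars* ts)
  bindings-⟨⟩ (var x)   σ = refl
  bindings-⟨⟩ (op f ts) σ = bindings-⟨⟩* ts σ
  bindings-⟨⟩* []       σ = refl
  bindings-⟨⟩* (t ∷ ts) σ =
    trans (cong₂ _++_ (bindings-⟨⟩ t σ) (bindings-⟨⟩* ts σ)) (sym (map-++ (λ x → x , σ x) (vars t) (vars* ts)))

  -- The bindings read off t and u are those of any matcher, which they
  -- therefore determine on the variables of t.
  matches? : ∀ t u → Dec (∃ λ σ → t ⟨ σ ⟩ ≡ u)
  matches? t u with t ⟨ look (var 0) (bindings t u) ⟩ ≟T u
  ... | yes eq = yes (_ , eq)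
  ... | no neq = no λ { (σ , refl) → neq (⟨⟩-cong t λ x∈ →
      trans (cong (λ ps → look (var 0) ps _) (bindings-⟨⟩ t σ)) (look-graph (var 0) σ x∈)) }

  heightArgs-≤ : ∀ {n b} (ts : Vec (Term F) n) → (∀ i → height (lookup ts i) ≤ b) → heightArgs ts ≤ suc b
  heightArgs-≤ []       _  = z≤n
  heightArgs-≤ {b = b} (t ∷ ts) ≤b = s≤s (max-≤ (t ∷ ts) ≤b)
    where
    max-≤ : ∀ {n} (ts : Vec (Term F) n) → (∀ i → height (lookup ts i) ≤ b) → maxHeight ts ≤ b
    max-≤ []       _  = z≤n
    max-≤ (t ∷ ts) ≤b = ℕ.⊔-lub (≤b zero) (max-≤ ts (≤b ∘ suc))

  height-arg : ∀ {n b} (ts : Vec (Term F) n) → heightArgs ts ≤ suc b → ∀ i → height (lookup ts i) ≤ b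
  height-arg {b = b} (t ∷ ts) (s≤s h≤) = from-max (t ∷ ts) h≤
    where
    from-max : ∀ {n} (ts : Vec (Term F) n) → maxHeight ts ≤ b → ∀ i → height (lookup ts i) ≤ b
    from-max (t ∷ ts) h≤ zero    = ℕ.m⊔n≤o⇒m≤o (height t) (maxHeight ts) h≤
    from-max (t ∷ ts) h≤ (suc i) = from-max ts (ℕ.m⊔n≤o⇒n≤o (height t) (maxHeight ts) h≤) i

  heightArgs≤0 : ∀ {n} (ts : Vec (Term F) n) → heightArgs ts ≤ 0 → n ≡ 0
  heightArgs≤0 [] _ = refl

-- Flat terms over atoms

module Rewriting {F : Signature} (R : TRS F) where

  Normal : Term F → Set
  Normal = IsNormalForm (R ⊢_⟶_)

  Reducible : Term F → Set
  Reducible t = ∃ λ u → R ⊢ t ⟶ u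

  ⟶-⟨⟩ : ∀ {t u} τ → R ⊢ t ⟶ u → R ⊢ t ⟨ τ ⟩ ⟶ u ⟨ τ ⟩
  ⟶-⟨⟩ τ (root {ρ} ρ∈R σ) =
    subst₂ (R ⊢_⟶_) (sym (⟨⟩-⟨⟩ (lhs ρ) σ τ)) (sym (⟨⟩-⟨⟩ (rhs ρ) σ τ)) (root ρ∈R _)
  ⟶-⟨⟩ τ (arg {f} ts i {u} t⟶u) =
    subst (λ us → R ⊢ op f (ts ⟨ τ ⟩*) ⟶ op f us) (sym (update-⟨⟩* ts τ i u))
      (arg (ts ⟨ τ ⟩*) i (subst (R ⊢_⟶ u ⟨ τ ⟩) (sym (lookup-⟨⟩* ts τ i)) (⟶-⟨⟩ τ t⟶u)))

  -- A redex survives every substitution. This reduces the existence of a normal instance to the one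
  -- in which variables stand for themselves.
  normal-⟨⟩⁻ : ∀ {t} τ → Normal (t ⟨ τ ⟩) → Normal t
  normal-⟨⟩⁻ τ nf (_ , t⟶u) = nf (_ , ⟶-⟨⟩ τ t⟶u)

  normal-arg : ∀ {f ts} → Normal (op f ts) → ∀ i → Normal (lookup ts i)
  normal-arg nf i (_ , t⟶u) = nf (_ , arg _ i t⟶u)

  RootReducible : Term F → Set
  RootReducible t = Any (λ ρ → ∃ λ σ → lhs ρ ⟨ σ ⟩ ≡ t) R

  root-reducible : ∀ {t} → RootReducible t → Reducible t
  root-reducible red with ρ , ρ∈R , σ , refl ← find red = _ , root ρ∈R σ

  instance≢var : ∀ (ρ : Rule F) σ {x} → lhs ρ ⟨ σ ⟩ ≢ var x
  instance≢var ρ σ with lhs ρ in eq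
  ... | var x   = λ _ → lhs≢var ρ x eq
  ... | op f ts = λ ()

  var-normal : ∀ {x} → Normal (var x)
  var-normal (_ , s) = go s refl
    where
    go : ∀ {t u x} → R ⊢ t ⟶ u → t ≢ var x
    go (root {ρ} _ σ) eq = instance≢var ρ σ eq

  -- The source is a separate `t` with an equation because `lhs ρ ⟨ σ ⟩`, the source of a root step,
  -- does not unify with `op f ts`.
  op-reducible : ∀ {f ts t} → Reducible t → t ≡ op f ts →
                 RootReducible t ⊎ ∃ λ i → Reducible (lookup ts i)
  op-reducible (_ , root ρ∈R σ)      _    = inj₁ (lose ρ∈R (σ , refl))
  op-reducible (_ , arg ts i t⟶u) refl = inj₂ (i , _ , t⟶u)

  abstract
    reducible?  : ∀ t → Dec (Reducible t)
    reducible*? : ∀ {n} (ts : Vec (Term F) n) → Dec (∃ λ i → Reducible (lookup ts i))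
    reducible? (var x) = no var-normal
    reducible? (op f ts) =
      map′ [ root-reducible , (λ { (i , _ , t⟶u) → _ , arg ts i t⟶u }) ]′
           (λ r → op-reducible r refl)
           (any? (λ ρ → matches? (lhs ρ) (op f ts)) R ⊎-dec reducible*? ts)
    reducible*? []       = no λ ()
    reducible*? (t ∷ ts) = map′ [ (zero ,_) , (λ { (i , r) → suc i , r }) ]′
      (λ { (zero , r) → inj₁ r ; (suc i , r) → inj₂ (i , r) }) (reducible? t ⊎-dec reducible*? ts)

    normal? : ∀ t → Dec (Normal t)
    normal? t = ¬? (reducible? t)

  ↔*-sym : ∀ {t u} → R ⊢ t ↔* u → R ⊢ u ↔* t
  ↔*-sym = Eq.symmetric _

  ↔*-update : ∀ {f} (ts : Vec (Term F) (arity F f)) i {u v} →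
              R ⊢ u ↔* v → R ⊢ op f (ts [ i ]≔ u) ↔* op f (ts [ i ]≔ v)
  ↔*-update {f} ts i = Eq.gmap (λ u → op f (ts [ i ]≔ u)) λ {u} {v} u⟶v →
    subst (λ us → R ⊢ op f (ts [ i ]≔ u) ⟶ op f us) (Vec.[]≔-idempotent ts i)
      (arg (ts [ i ]≔ u) i (subst (R ⊢_⟶ v) (sym (Vec.lookup∘update i ts u)) u⟶v))

  ↔*-args : ∀ {f} (ts us : Vec (Term F) (arity F f)) →
            (∀ i → R ⊢ lookup ts i ↔* lookup us i) → R ⊢ op f ts ↔* op f us
  ↔*-args {f} ts us = go (op f) ↔*-update ts us
    where
    -- `C` is the context in which the arguments already treated have been replaced.
    go : ∀ {n} (C : Vec (Term F) n → Term F) →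
         (∀ ts i {u v} → R ⊢ u ↔* v → R ⊢ C (ts [ i ]≔ u) ↔* C (ts [ i ]≔ v)) →
         ∀ ts us → (∀ i → R ⊢ lookup ts i ↔* lookup us i) → R ⊢ C ts ↔* C us
    go C upd []       []       eqs = ε
    go C upd (t ∷ ts) (u ∷ us) eqs =
      upd (t ∷ ts) zero (eqs zero) ◅◅
      go (C ∘ (u ∷_)) (λ ts i → upd (u ∷ ts) (suc i)) ts us (eqs ∘ suc)

  Const : Set
  Const = Fin (length (constants F))

  symbol : Const → Symbol F
  symbol = List.lookup (constants F)

  symbol-arity : ∀ k → arity F (symbol k) ≡ 0
  symbol-arity k = proj₂ (∈-filter⁻ (λ f → arity F f ≟ 0) {xs = allFin (size F)} (∈-lookup k))

  index-of : ∀ f → arity F f ≡ 0 → ∃ λ k → f ≡ symbol k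
  index-of f p = Any.index f∈ , lookup-index f∈
    where
    f∈ : f ∈ constants F
    f∈ = ∈-filter⁺ (λ f → arity F f ≟ 0) (∈-allFin f) p

  const : Const → Term F
  const k = op (symbol k) (empty (symbol-arity k))

  -- Three kinds of variables occur: numbers in the rules, elements of the model in its operations,
  -- and `Maybe V` when a fresh variable is required.
  data Atom (V : Set) : Set where
    con : Const → Atom V
    vr  : V → Atom V

  -- A constant is a flat term in two ways, app (symbol k) [] and at (con k);
  -- they are identified by _~_ but interpreted differently.
  data FTerm (V : Set) : Set where
    at  : Atom V → FTerm V
    app : (f : Symbol F) → Vec (Atom V) (arity F f) → FTerm V

  bindA : {V W : Set} → (V → Atom W) → Atom V → Atom W
  bindA σ (con k) = con k
  bindA σ (vr v)  = σ v

  bindF : {V W : Set} → (V → Atom W) → FTerm V → FTerm W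
  bindF σ (at a)     = at (bindA σ a)
  bindF σ (app f as) = app f (Vec.map (bindA σ) as)

  bindF-bindF : {U V W : Set} (σ : U → Atom V) (τ : V → Atom W) (t : FTerm U) →
                bindF τ (bindF σ t) ≡ bindF (bindA τ ∘ σ) t
  bindF-bindF σ τ = go
    where
    goA : ∀ a → bindA τ (bindA σ a) ≡ bindA (bindA τ ∘ σ) a
    goA (con k) = refl
    goA (vr v)  = refl
    go : ∀ t → bindF τ (bindF σ t) ≡ bindF (bindA τ ∘ σ) t
    go (at a)     = cong at (goA a)
    go (app f as) = cong (app f) (trans (sym (Vec.map-∘ _ _ as)) (Vec.map-cong goA as))

  varsA : {V : Set} → Atom V → List V
  varsA (con k) = []
  varsA (vr v)  = v ∷ []

  varsA* : {V : Set} → ∀ {n} → Vec (Atom V) n → List V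
  varsA* []       = []
  varsA* (a ∷ as) = varsA a ++ varsA* as

  varsF : {V : Set} → FTerm V → List V
  varsF (at a)     = varsA a
  varsF (app f as) = varsA* as

  ∈-varsA* : {V : Set} → ∀ {n} (as : Vec (Atom V) n) i {v} → v ∈ varsA (lookup as i) → v ∈ varsA* as
  ∈-varsA* (a ∷ as) zero    v∈ = ∈-++⁺ˡ v∈
  ∈-varsA* (a ∷ as) (suc i) v∈ = ∈-++⁺ʳ (varsA a) (∈-varsA* as i v∈)

  length-varsA* : {V : Set} → ∀ {n} (as : Vec (Atom V) n) → length (varsA* as) ≤ n
  length-varsA* []           = z≤n
  length-varsA* (con k ∷ as) = ℕ.m≤n⇒m≤1+n (length-varsA* as)
  length-varsA* (vr v ∷ as)  = s≤s (length-varsA* as)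

  module _ {V W : Set} {σ τ : V → Atom W} where

    bindA-cong : ∀ a → (∀ {v} → v ∈ varsA a → σ v ≡ τ v) → bindA σ a ≡ bindA τ a
    bindA-cong (con k) eq = refl
    bindA-cong (vr v)  eq = eq (here refl)

    bindF-cong : ∀ t → (∀ {v} → v ∈ varsF t → σ v ≡ τ v) → bindF σ t ≡ bindF τ t
    bindF-cong (at a)     eq = cong at (bindA-cong a eq)
    bindF-cong (app f as) eq = cong (app f) (go as eq)
      where
      go : ∀ {n} (as : Vec (Atom V) n) → (∀ {v} → v ∈ varsA* as → σ v ≡ τ v) →
           Vec.map (bindA σ) as ≡ Vec.map (bindA τ) as
      go []       eq = refl
      go (a ∷ as) eq = cong₂ _∷_ (bindA-cong a (eq ∘ ∈-++⁺ˡ)) (go as (eq ∘ ∈-++⁺ʳ (varsA a)))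

  bindF-vr : {V : Set} (t : FTerm V) → bindF vr t ≡ t
  bindF-vr (at (con k)) = refl
  bindF-vr (at (vr v))  = refl
  bindF-vr (app f as)   = cong (app f) (trans (Vec.map-cong go as) (Vec.map-id as))
    where
    go : ∀ a → bindA vr a ≡ a
    go (con k) = refl
    go (vr v)  = refl

  bindF-id : {V : Set} {σ : V → Atom V} (t : FTerm V) → (∀ {v} → v ∈ varsF t → σ v ≡ vr v) → bindF σ t ≡ t
  bindF-id t eq = trans (bindF-cong t eq) (bindF-vr t)

  -- On terms of height at least 1 the result is junk.
  toAtom : Term F → Atom Variable
  toAtom (var x) = vr x
  toAtom (op f ts) with arity F f ≟ 0
  ... | yes p = con (proj₁ (index-of f p))
  ... | no _  = vr 0

  flatten : Term F → FTerm Variable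
  flatten (var x)   = at (vr x)
  flatten (op f ts) = app f (Vec.map toAtom ts)

  op≡const : ∀ {f k} → f ≡ symbol k → ∀ ts → op f ts ≡ const k
  op≡const refl ts = cong (op _) (empty-unique _ ts)

  toAtom-const : ∀ f ts → height (op f ts) ≤ 0 → ∃ λ k → toAtom (op f ts) ≡ con k × op f ts ≡ const k
  toAtom-const f ts h with arity F f ≟ 0
  ... | yes p = _ , refl , op≡const (proj₂ (index-of f p)) ts
  ... | no ¬p = contradiction (heightArgs≤0 ts h) ¬p

  -- Equivalence of flat terms

  infix 4 _~_
  -- No derivation leaves the flat terms: rules are instantiated by atoms, and arguments are
  -- exchanged for equivalent atoms.
  data _~_ {V : Set} : FTerm V → FTerm V → Set where
    ~rule  : ∀ {ρ} → ρ ∈ R → (σ : Variable → Atom V) → bindF σ (flatten (lhs ρ)) ~ bindF σ (flatten (rhs ρ))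
    ~con   : ∀ k as → app (symbol k) as ~ at (con k)
    ~cong  : ∀ {f as bs} → (∀ i → at (lookup as i) ~ at (lookup bs i)) → app f as ~ app f bs
    ~refl  : ∀ {t} → t ~ t
    ~sym   : ∀ {t u} → t ~ u → u ~ t
    ~trans : ∀ {t u v} → t ~ u → u ~ v → t ~ v

  ~bind : {V W : Set} (τ : V → Atom W) → ∀ {t u} → t ~ u → bindF τ t ~ bindF τ u
  ~bind τ (~rule {ρ} ρ∈R σ) = subst₂ _~_
    (sym (bindF-bindF σ τ (flatten (lhs ρ)))) (sym (bindF-bindF σ τ (flatten (rhs ρ)))) (~rule ρ∈R _)
  ~bind τ (~con k as)   = ~con k _
  ~bind τ (~cong {as = as} {bs} eqs) = ~cong λ i → subst₂ (λ a b → at a ~ at b)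
    (sym (Vec.lookup-map i (bindA τ) as)) (sym (Vec.lookup-map i (bindA τ) bs)) (~bind τ (eqs i))
  ~bind τ ~refl         = ~refl
  ~bind τ (~sym p)      = ~sym (~bind τ p)
  ~bind τ (~trans p q)  = ~trans (~bind τ p) (~bind τ q)

  atoms : {V : Set} → List V → List (Atom V)
  atoms vs = List.map con (allFin _) ++ List.map vr vs

  ∈-atoms : {V : Set} {vs : List V} → ∀ a → (∀ {v} → v ∈ varsA a → v ∈ vs) → a ∈ atoms vs
  ∈-atoms (con k) ⊆vs = ∈-++⁺ˡ (∈-map⁺ con (∈-allFin k))
  ∈-atoms (vr v)  ⊆vs = ∈-++⁺ʳ _ (∈-map⁺ vr (⊆vs (here refl)))

  apps : {V : Set} → List V → Symbol F → List (FTerm V)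
  apps vs f = List.map (app f) (vectors (atoms vs) (arity F f))

  flatTerms : {V : Set} → List V → List (FTerm V)
  flatTerms vs = List.map at (atoms vs) ++ concatMap (apps vs) (allFin (size F))

  ∈-flatTerms : {V : Set} {vs : List V} → ∀ t → (∀ {v} → v ∈ varsF t → v ∈ vs) → t ∈ flatTerms vs
  ∈-flatTerms (at a) ⊆vs = ∈-++⁺ˡ (∈-map⁺ at (∈-atoms a ⊆vs))
  ∈-flatTerms {vs = vs} (app f as) ⊆vs = ∈-++⁺ʳ (List.map at (atoms vs)) (∈-concatMap⁺ (apps vs)
    (lose (∈-allFin f) (∈-map⁺ (app f) (∈-vectors as λ i → ∈-atoms (lookup as i) (⊆vs ∘ ∈-varsA* as i)))))

  bindingsA : {V : Set} → Atom Variable → Atom V → List (Variable × Atom V)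
  bindingsA (con k) a = []
  bindingsA (vr x)  a = (x , a) ∷ []

  bindingsA* : {V : Set} → ∀ {n m} → Vec (Atom Variable) n → Vec (Atom V) m → List (Variable × Atom V)
  bindingsA* (p ∷ ps) (a ∷ as) = bindingsA p a ++ bindingsA* ps as
  bindingsA* _        _        = []

  bindingsF : {V : Set} → FTerm Variable → FTerm V → List (Variable × Atom V)
  bindingsF (at p)     (at a)     = bindingsA p a
  bindingsF (app f ps) (app g as) = bindingsA* ps as
  bindingsF _          _          = []

  bindingsF-bindF : {V : Set} (σ : Variable → Atom V) (t : FTerm Variable) →
                    bindingsF t (bindF σ t) ≡ List.map (λ x → x , σ x) (varsF t)
  bindingsF-bindF {V} σ = go
    where
    graph : List Variable → List (Variable × Atom V)
    graph = List.map (λ x → x , σ x)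
    goA : ∀ p → bindingsA p (bindA σ p) ≡ graph (varsA p)
    goA (con k) = refl
    goA (vr x)  = refl
    goA* : ∀ {n} (ps : Vec _ n) → bindingsA* ps (Vec.map (bindA σ) ps) ≡ graph (varsA* ps)
    goA* []       = refl
    goA* (p ∷ ps) = trans (cong₂ _++_ (goA p) (goA* ps)) (sym (map-++ _ (varsA p) (varsA* ps)))
    go : ∀ t → bindingsF t (bindF σ t) ≡ graph (varsF t)
    go (at p)     = goA p
    go (app f ps) = goA* ps

  -- Deciding the equivalence by saturation

  module Decide {V : Set} (_≟V_ : DecidableEquality V) (v₀ : V) where

    open import Data.List.Membership.DecPropositional _≟V_ using () renaming (_∈?_ to _∈V?_)

    infix 4 _≟A_ _≟FT_ _~?_

    _≟A_ : DecidableEquality (Atom V)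
    con k ≟A con l = map′ (cong con) (λ { refl → refl }) (k ≟F l)
    con k ≟A vr w  = no λ ()
    vr v  ≟A con l = no λ ()
    vr v  ≟A vr w  = map′ (cong vr) (λ { refl → refl }) (v ≟V w)

    _≟FT_ : DecidableEquality (FTerm V)
    at a ≟FT at b = map′ (cong at) (λ { refl → refl }) (a ≟A b)
    at a ≟FT app g bs = no λ ()
    app f as ≟FT at b = no λ ()
    app f as ≟FT app g bs with f ≟F g
    ... | no f≢g   = no λ { refl → f≢g refl }
    ... | yes refl = map′ (cong (app f)) (λ { refl → refl }) (Vec.≡-dec _≟A_ as bs)

    Pair : Set
    Pair = FTerm V × FTerm V

    open import Data.List.Membership.DecPropositional (≡-dec _≟FT_ _≟FT_) using () renaming (_∈?_ to _∈P?_)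

    RuleInstance : Pair → Rule F → Set
    RuleInstance (t , u) ρ = ∃ λ σ → bindF σ (flatten (lhs ρ)) ≡ t × bindF σ (flatten (rhs ρ)) ≡ u

    -- Bindings are read off both sides since the right side may have variables that the left side
    -- lacks.
    ruleInstance? : ∀ tu ρ → Dec (RuleInstance tu ρ)
    ruleInstance? (t , u) ρ
      with σ₀ ← look (vr v₀) (bindingsF (flatten (lhs ρ)) t ++ bindingsF (flatten (rhs ρ)) u) in eq
      with (bindF σ₀ (flatten (lhs ρ)) ≟FT t) ×-dec (bindF σ₀ (flatten (rhs ρ)) ≟FT u)
    ... | yes p = yes (σ₀ , p)
    ... | no ¬p = no λ { (σ , refl , refl) →
        ¬p (bindF-cong l (agree σ eq ∘ ∈-++⁺ˡ) , bindF-cong r (agree σ eq ∘ ∈-++⁺ʳ (varsF l))) }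
      where
      l = flatten (lhs ρ)
      r = flatten (rhs ρ)
      agree : ∀ σ {σ₀} → look (vr v₀) (bindingsF l (bindF σ l) ++ bindingsF r (bindF σ r)) ≡ σ₀ →
              ∀ {x} → x ∈ varsF l ++ varsF r → σ₀ x ≡ σ x
      agree σ refl x∈ = trans
        (cong (λ ps → look (vr v₀) ps _)
          (trans (cong₂ _++_ (bindingsF-bindF σ l) (bindingsF-bindF σ r)) (sym (map-++ _ (varsF l) (varsF r)))))
        (look-graph (vr v₀) σ x∈)

    ConInstance : Pair → Set
    ConInstance (app f as , at (con k)) = f ≡ symbol k
    ConInstance _                       = ⊥

    conInstance? : ∀ tu → Dec (ConInstance tu)
    conInstance? (app f as , at (con k)) = f ≟F symbol k
    conInstance? (app f as , at (vr v))  = no λ ()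
    conInstance? (app f as , app g bs)   = no λ ()
    conInstance? (at a , u)              = no λ ()

    CongInstance : List Pair → Pair → Set
    CongInstance S (app f as , app g bs) =
      Σ (f ≡ g) λ { refl → ∀ i → (at (lookup as i) , at (lookup bs i)) ∈ S }
    CongInstance S _ = ⊥

    congInstance? : ∀ S tu → Dec (CongInstance S tu)
    congInstance? S (app f as , app g bs) with f ≟F g
    ... | no f≢g   = no (f≢g ∘ proj₁)
    ... | yes refl = map′ (refl ,_) (λ { (refl , p) → p })
                       (allFin? λ i → (at (lookup as i) , at (lookup bs i)) ∈P? S)
    congInstance? S (at a , u)         = no λ ()
    congInstance? S (app f as , at b)  = no λ ()

    module Saturate (vs : List V) (v₀∈vs : v₀ ∈ vs) where

      Derived : List Pair → Pair → Set
      Derived S (t , u) =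
        t ≡ u ⊎ (u , t) ∈ S ⊎ Any (λ s → (t , s) ∈ S × (s , u) ∈ S) (flatTerms vs) ⊎
        Any (RuleInstance (t , u)) R ⊎ ConInstance (t , u) ⊎ CongInstance S (t , u)

      derived? : ∀ S tu → Dec (Derived S tu)
      derived? S (t , u) =
        (t ≟FT u) ⊎-dec ((u , t) ∈P? S) ⊎-dec
        any? (λ s → ((t , s) ∈P? S) ×-dec ((s , u) ∈P? S)) (flatTerms vs) ⊎-dec
        any? (ruleInstance? (t , u)) R ⊎-dec conInstance? (t , u) ⊎-dec congInstance? S (t , u)

      Sound : List Pair → Set
      Sound = All (λ { (t , u) → t ~ u })

      derived-sound : ∀ {S} → Sound S → ∀ t u → Derived S (t , u) → t ~ u
      derived-sound S-sound t u (inj₁ refl) = ~refl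
      derived-sound S-sound t u (inj₂ (inj₁ ut∈)) = ~sym (All.lookup S-sound ut∈)
      derived-sound S-sound t u (inj₂ (inj₂ (inj₁ p)))
        with s , _ , ts∈ , su∈ ← find p = ~trans (All.lookup S-sound ts∈) (All.lookup S-sound su∈)
      derived-sound S-sound t u (inj₂ (inj₂ (inj₂ (inj₁ p))))
        with ρ , ρ∈R , σ , refl , refl ← find p = ~rule ρ∈R σ
      derived-sound S-sound t u (inj₂ (inj₂ (inj₂ (inj₂ (inj₁ p))))) = con-sound t u p
        where
        con-sound : ∀ t u → ConInstance (t , u) → t ~ u
        con-sound (app _ as) (at (con k)) refl = ~con k as
      derived-sound {S} S-sound t u (inj₂ (inj₂ (inj₂ (inj₂ (inj₂ p))))) = cong-sound t u p
        where
        cong-sound : ∀ t u → CongInstance S (t , u) → t ~ u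
        cong-sound (app _ as) (app _ bs) (refl , p) = ~cong λ i → All.lookup S-sound (p i)

      Closed : List Pair → Set
      Closed S = ∀ {t u} → t ∈ flatTerms vs → u ∈ flatTerms vs → Derived S (t , u) → (t , u) ∈ S

      -- A pair over `vs` that is derivable but missing is added, which raises the number of such
      -- pairs in the list; soundness is carried along in the state.
      saturated : ∃ λ S → Sound S × Closed S
      saturated = ascend {S = Σ (List Pair) Sound} μ (length pairs)
                    (λ s → length-filter (_∈P? proj₁ s) pairs) step ([] , [])
        where
        pairs : List Pair
        pairs = cartesianProduct (flatTerms vs) (flatTerms vs)
        μ : Σ (List Pair) Sound → ℕ
        μ (S , _) = length (filter (_∈P? S) pairs)
        step : ∀ s → (∃ λ S → Sound S × Closed S) ⊎ ∃ λ s′ → μ s < μ s′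
        step (S , S-sound) with any? (λ tu → ¬? (tu ∈P? S) ×-dec derived? S tu) pairs
        ... | yes p with (t , u) , tu∈ , tu∉S , der ← find p =
          inj₂ (((t , u) ∷ S , derived-sound S-sound t u der ∷ S-sound) ,
                length-filter-strict (_∈P? S) (_∈P? ((t , u) ∷ S)) there tu∈ tu∉S (here refl))
        ... | no ¬p = inj₁ (S , S-sound , λ {t} {u} t∈ u∈ der → closed t∈ u∈ der)
          where
          closed : Closed S
          closed {t} {u} t∈ u∈ der with (t , u) ∈P? S
          ... | yes tu∈S = tu∈S
          ... | no tu∉S  = contradiction (lose (∈-cartesianProduct⁺ t∈ u∈) (tu∉S , der)) ¬p

      -- Derivations may be confined to vs, since renaming the other variables
      -- to v₀ ∈ vs preserves them.
      confine : V → Atom V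
      confine v with v ∈V? vs
      ... | yes _ = vr v
      ... | no _  = vr v₀

      confine-∈ : ∀ {v} → v ∈ vs → confine v ≡ vr v
      confine-∈ {v} v∈ with v ∈V? vs
      ... | yes _  = refl
      ... | no v∉ = contradiction v∈ v∉

      confine-vars : ∀ v {w} → w ∈ varsA (confine v) → w ∈ vs
      confine-vars v w∈ with v ∈V? vs
      confine-vars v (here refl) | yes v∈ = v∈
      confine-vars v (here refl) | no _   = v₀∈vs

      confined : ∀ t → bindF confine t ∈ flatTerms vs
      confined t = ∈-flatTerms (bindF confine t) (go t)
        where
        goA : ∀ a {w} → w ∈ varsA (bindA confine a) → w ∈ vs
        goA (vr v) w∈ = confine-vars v w∈
        goA* : ∀ {n} (as : Vec (Atom V) n) {w} → w ∈ varsA* (Vec.map (bindA confine) as) → w ∈ vs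
        goA* (a ∷ as) w∈ = [ goA a , goA* as ]′ (∈-++⁻ (varsA (bindA confine a)) w∈)
        go : ∀ t {w} → w ∈ varsF (bindF confine t) → w ∈ vs
        go (at a)     = goA a
        go (app f as) = goA* as

      complete : ∀ {S} → Closed S → ∀ {t u} → t ~ u → (bindF confine t , bindF confine u) ∈ S
      complete {S} closed = go
        where
        close : ∀ {t u} → Derived S (bindF confine t , bindF confine u) →
                (bindF confine t , bindF confine u) ∈ S
        close {t} {u} = closed (confined t) (confined u)
        go : ∀ {t u} → t ~ u → (bindF confine t , bindF confine u) ∈ S
        go (~rule {ρ} ρ∈R σ) = close {bindF σ (flatten (lhs ρ))} {bindF σ (flatten (rhs ρ))}
          (inj₂ (inj₂ (inj₂ (inj₁ (lose ρ∈R
            (bindA confine ∘ σ , sym (bindF-bindF σ confine (flatten (lhs ρ))) ,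
             sym (bindF-bindF σ confine (flatten (rhs ρ)))))))))
        go (~con k as) = close {app (symbol k) as} {at (con k)} (inj₂ (inj₂ (inj₂ (inj₂ (inj₁ refl)))))
        go (~cong {f} {as} {bs} eqs) = close {app f as} {app f bs}
          (inj₂ (inj₂ (inj₂ (inj₂ (inj₂ (refl , λ i → subst₂ (λ a b → (at a , at b) ∈ S)
            (sym (Vec.lookup-map i (bindA confine) as)) (sym (Vec.lookup-map i (bindA confine) bs))
            (go (eqs i))))))))
        go (~refl {t}) = close {t} {t} (inj₁ refl)
        go (~sym {t} {u} p) = close {u} {t} (inj₂ (inj₁ (go p)))
        go (~trans {t} {u} {v} p q) = close {t} {v} (inj₂ (inj₂ (inj₁ (lose (confined u) (go p , go q)))))

    abstract
      _~?_ : ∀ (t u : FTerm V) → Dec (t ~ u)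
      -- The list contains the variables of both terms, so confinement leaves them unchanged; `v₀`
      -- is the target for all other variables.
      t ~? u with S , S-sound , closed ← Saturate.saturated (v₀ ∷ varsF t ++ varsF u) (here refl)
        with (t , u) ∈P? S
      ... | yes tu∈ = yes (All.lookup S-sound tu∈)
      ... | no tu∉  = no λ t~u → tu∉ (subst₂ (λ t u → (t , u) ∈ S)
          (bindF-id t (Sat.confine-∈ ∘ there ∘ ∈-++⁺ˡ)) (bindF-id u (Sat.confine-∈ ∘ there ∘ ∈-++⁺ʳ (varsF t)))
          (Sat.complete closed t~u))
        where
        module Sat = Saturate (v₀ ∷ varsF t ++ varsF u) (here refl)

-- Normal forms of constants

module FlatRewriting {F : Signature} (R : TRS F) (R-flat : Flat R) where

  open Rewriting R public

  BoundedWitness : Set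
  BoundedWitness = ∃₂ λ M N → Witness R M N × height M ≤ bound F × height N ≤ bound F

  module _ {V : Set} (κ : Const → Term F) (τ : V → Term F) where

    ev : Atom V → Term F
    ev (con k) = κ k
    ev (vr v)  = τ v

    -- `κ` acts on atoms alone, so `app (symbol k) as` denotes the constant itself even when `κ k`
    -- is another term.
    ⟦_⟧ : FTerm V → Term F
    ⟦ at a ⟧     = ev a
    ⟦ app f as ⟧ = op f (Vec.map ev as)

  module _ {V W : Set} (κ : Const → Term F) (σ : V → Atom W) (τ : W → Term F) where

    ev-bindA : ∀ a → ev κ τ (bindA σ a) ≡ ev κ (ev κ τ ∘ σ) a
    ev-bindA (con k) = refl
    ev-bindA (vr v)  = refl

    ⟦⟧-bindF : ∀ t → ⟦_⟧ κ τ (bindF σ t) ≡ ⟦_⟧ κ (ev κ τ ∘ σ) t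
    ⟦⟧-bindF (at a)     = ev-bindA a
    ⟦⟧-bindF (app f as) = cong (op f) (trans (sym (Vec.map-∘ _ _ as)) (Vec.map-cong ev-bindA as))

  const-⟨⟩ : ∀ k σ → const k ⟨ σ ⟩ ≡ const k
  const-⟨⟩ k σ = op≡const refl _

  module _ {V : Set} (κ : Const → Term F) (κ↔ : ∀ k → R ⊢ κ k ↔* const k) (τ : V → Term F) where

    ↔*-lookup-map : ∀ {A : Set} {n} (g : A → Term F) (h : A → Term F) (as : Vec A n) (i : Fin n) →
                    R ⊢ g (lookup as i) ↔* h (lookup as i) →
                    R ⊢ lookup (Vec.map g as) i ↔* lookup (Vec.map h as) i
    ↔*-lookup-map g h as i = subst₂ (R ⊢_↔*_) (sym (Vec.lookup-map i g as)) (sym (Vec.lookup-map i h as))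

    ev-toAtom : ∀ (σ : Variable → Atom V) t → height t ≤ 0 → R ⊢ ev κ τ (bindA σ (toAtom t)) ↔* t ⟨ ev κ τ ∘ σ ⟩
    ev-toAtom σ (var x)   h = ε
    ev-toAtom σ (op f ts) h with k , eq , t≡k ← toAtom-const f ts h =
      subst₂ (λ a u → R ⊢ ev κ τ (bindA σ a) ↔* u) (sym eq)
        (sym (trans (cong (_⟨ ev κ τ ∘ σ ⟩) t≡k) (const-⟨⟩ k _))) (κ↔ k)

    -- Convertible rather than equal, because constant arguments of `t` turn into their values under
    -- `κ`.
    ⟦⟧-flatten : ∀ (σ : Variable → Atom V) t → FlatTerm t →
                 R ⊢ ⟦_⟧ κ τ (bindF σ (flatten t)) ↔* t ⟨ ev κ τ ∘ σ ⟩
    ⟦⟧-flatten σ (var x)   h = ε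
    ⟦⟧-flatten σ (op f ts) h
      rewrite ⟨⟩*-map ts (ev κ τ ∘ σ)
            | sym (Vec.map-∘ (bindA σ) toAtom ts)
            | sym (Vec.map-∘ (ev κ τ) (bindA σ ∘ toAtom) ts) =
      ↔*-args _ _ λ i → ↔*-lookup-map _ _ ts i (ev-toAtom σ (lookup ts i) (height-arg ts h i))

    -- A rule instance over atoms becomes a root step between two conversions that exchange
    -- constants and their values under `κ`.
    ~⇒↔* : ∀ {t u} → t ~ u → R ⊢ ⟦_⟧ κ τ t ↔* ⟦_⟧ κ τ u
    ~⇒↔* (~rule {ρ} ρ∈R σ) with l-flat , r-flat ← All.lookup R-flat ρ∈R =
      ⟦⟧-flatten σ (lhs ρ) l-flat ◅◅ fwd (root ρ∈R _) ◅ ↔*-sym (⟦⟧-flatten σ (rhs ρ) r-flat)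
    ~⇒↔* (~con k as) = subst (R ⊢_↔* κ k) (sym (op≡const refl _)) (↔*-sym (κ↔ k))
    ~⇒↔* (~cong {as = as} {bs} eqs) = ↔*-args _ _ λ i →
      subst₂ (R ⊢_↔*_) (sym (Vec.lookup-map i (ev κ τ) as)) (sym (Vec.lookup-map i (ev κ τ) bs)) (~⇒↔* (eqs i))
    ~⇒↔* ~refl        = ε
    ~⇒↔* (~sym p)     = ↔*-sym (~⇒↔* p)
    ~⇒↔* (~trans p q) = ~⇒↔* p ◅◅ ~⇒↔* q

  open Decide _≟_ 0 public using (_~?_)

  -- Classes of constants and their assigned terms

  infix 4 _≈_ _≈?_
  _≈_ : Const → Const → Set
  k ≈ l = _~_ {V = Variable} (at (con k)) (at (con l))

  _≈?_ : ∀ k l → Dec (k ≈ l)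
  k ≈? l = at (con k) ~? at (con l)

  ~con′ : ∀ {V : Set} {f k} → f ≡ symbol k → ∀ (as : Vec (Atom V) (arity F f)) → app f as ~ at (con k)
  ~con′ refl as = ~con _ as

  symbol≡⇒≈ : ∀ {k l} → symbol k ≡ symbol l → k ≈ l
  symbol≡⇒≈ {k} eq = ~trans (~sym (~con k (empty (symbol-arity k)))) (~con′ eq _)

  op-injective : ∀ {f g ts us} → _≡_ {A = Term F} (op f ts) (op g us) →
                 Σ (f ≡ g) λ eq → subst (Vec (Term F) ∘ arity F) eq ts ≡ us
  op-injective refl = refl , refl

  const≡⇒≈ : ∀ {k l} → const k ≡ const l → k ≈ l
  const≡⇒≈ eq = symbol≡⇒≈ (proj₁ (op-injective eq))

  headOr : {A : Set} → A → List A → A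
  headOr d []      = d
  headOr d (x ∷ _) = x

  headOr-∈ : {A : Set} {d x : A} {xs : List A} → x ∈ xs → headOr d xs ∈ xs
  headOr-∈ (here _)  = here refl
  headOr-∈ (there _) = here refl

  headOr-default : {A : Set} {d e x : A} {xs : List A} → x ∈ xs → headOr d xs ≡ headOr e xs
  headOr-default (here _)  = refl
  headOr-default (there _) = refl

  -- The first member of the class in the enumeration; the default never shows, as the class
  -- contains `k`.
  repr : Const → Const
  repr k = headOr k (filter (_≈? k) (allFin _))

  ∈-class : ∀ k → k ∈ filter (_≈? k) (allFin _)
  ∈-class k = ∈-filter⁺ (_≈? k) (∈-allFin k) ~refl

  repr-≈ : ∀ k → repr k ≈ k
  repr-≈ k = proj₂ (∈-filter⁻ (_≈? k) {xs = allFin _} (headOr-∈ (∈-class k)))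

  -- Both filters select the same nonempty list, so the different defaults do not matter.
  repr-cong : ∀ {k l} → k ≈ l → repr k ≡ repr l
  repr-cong {k} {l} k≈l = trans (headOr-default (∈-class k))
    (cong (headOr l) (filter-≐ (_≈? k) (_≈? l) ((λ p → ~trans p k≈l) , (λ p → ~trans p (~sym k≈l))) (allFin _)))

  ¬Fin0 : ∀ {n} → n ≡ 0 → ¬ Fin n
  ¬Fin0 refl ()

  -- The measure of progress of the greedy assignment and the source of the height bound. It counts
  -- constants, not classes.
  normals : (Const → Term F) → ℕ
  normals ρ = length (filter (λ k → normal? (ρ k)) (allFin _))

  -- One layer of a value: a flat term of the class whose arguments are constants with normal
  -- values. It shows that values are not variables and keeps the values of distinct classes apart.
  Unfolding : (Const → Term F) → Const → Term F → Set
  Unfolding ρ k t = ∃₂ λ f (ks : Vec Const (arity F f)) →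
    app {V = Variable} f (Vec.map con ks) ~ at (con k) ×
    t ≡ op f (Vec.map ρ ks) × (∀ i → Normal (ρ (lookup ks i)))

  -- ρ k is the assigned normal form of k if it is normal, and otherwise a
  -- constant which stands for the absence of one.
  record Assignment : Set where
    field
      ρ      : Const → Term F
      ρ-cong : ∀ {k l} → k ≈ l → ρ k ≡ ρ l
      ρ-inj  : ∀ {k l} → ρ k ≡ ρ l → k ≈ l
      ρ-↔*   : ∀ k → R ⊢ ρ k ↔* const k
      ρ-unfold : ∀ k → Unfolding ρ k (ρ k)
      ρ-height : ∀ k → height (ρ k) ≤ normals ρ ∸ 1
      ρ-ground : ∀ k σ → ρ k ⟨ σ ⟩ ≡ ρ k

    infix 30 _[_]
    _[_] : {V : Set} → FTerm V → (V → Term F) → Term F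
    t [ τ ] = ⟦_⟧ ρ τ t

    module _ {V : Set} (τ : V → Term F) (σ : Substitution F) where

      ev-⟨⟩ : ∀ a → ev ρ τ a ⟨ σ ⟩ ≡ ev ρ (_⟨ σ ⟩ ∘ τ) a
      ev-⟨⟩ (con k) = ρ-ground k σ
      ev-⟨⟩ (vr v)  = refl

      []-⟨⟩ : ∀ t → t [ τ ] ⟨ σ ⟩ ≡ t [ _⟨ σ ⟩ ∘ τ ]
      []-⟨⟩ (at a)     = ev-⟨⟩ a
      []-⟨⟩ (app f as) = cong (op f) (trans (⟨⟩*-map (Vec.map (ev ρ τ) as) σ)
        (trans (sym (Vec.map-∘ _ _ as)) (Vec.map-cong ev-⟨⟩ as)))

    normals≤ : normals ρ ≤ length (constants F)
    normals≤ = ℕ.≤-trans (length-filter (λ k → normal? (ρ k)) (allFin _)) (ℕ.≤-reflexive (length-tabulate id))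

    suc-normals≤ : suc (normals ρ ∸ 1) ≤ bound F
    suc-normals≤ = go normals≤
      where
      go : ∀ {d b} → d ≤ b → suc (d ∸ 1) ≤ 1 ⊔ b
      -- With no normal value yet, a symbol applied to atoms may still have height 1; this is the 1
      -- in `bound`.
      go {zero}  {b} _   = ℕ.m≤m⊔n 1 b
      go {suc d} {b} d<b = ℕ.≤-trans d<b (ℕ.m≤n⊔m 1 b)

    height-[var] : ∀ t → height (t [ var ]) ≤ bound F
    height-[var] t = ℕ.≤-trans (go t) suc-normals≤
      where
      goA : ∀ a → height (ev ρ var a) ≤ normals ρ ∸ 1
      goA (con k) = ρ-height k
      goA (vr v)  = z≤n
      go : ∀ t → height (t [ var ]) ≤ suc (normals ρ ∸ 1)
      go (at a)     = ℕ.m≤n⇒m≤1+n (goA a)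
      go (app f as) = heightArgs-≤ (Vec.map (ev ρ var) as) λ i →
        subst (λ t → height t ≤ normals ρ ∸ 1) (sym (Vec.lookup-map i (ev ρ var) as)) (goA (lookup as i))

    boundedWitness : ∀ t u → t ~ u → Normal (t [ var ]) → Normal (u [ var ]) →
                     t [ var ] ≢ u [ var ] → BoundedWitness
    boundedWitness t u t~u t-nf u-nf t≢u =
      t [ var ] , u [ var ] ,
      record { normalˡ = t-nf ; normalʳ = u-nf ; distinct = t≢u ; equivalent = ~⇒↔* ρ ρ-↔* var t~u } ,
      height-[var] t , height-[var] u

    -- A normal form of a ground class which contains a variable stays in the
    -- class when that variable is renamed.
    shiftWitness : ∀ {k} t → t ~ at (con k) → Normal (t [ var ]) →
                   t [ var ] ≢ t [ var ∘ suc ] → BoundedWitness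
    shiftWitness t t~k t-nf t≢ = boundedWitness t (bindF (vr ∘ suc) t)
      (~trans t~k (~sym (~bind (vr ∘ suc) t~k))) t-nf
      -- `pred` undoes the shift, so the shifted term has a normal instance and is normal itself.
      (normal-⟨⟩⁻ (var ∘ pred)
        (subst Normal (sym (trans (cong (_⟨ var ∘ pred ⟩) shift) ([]-⟨⟩ (var ∘ suc) (var ∘ pred) t))) t-nf))
      (λ eq → t≢ (trans eq shift))
      where
      shift : bindF (vr ∘ suc) t [ var ] ≡ t [ var ∘ suc ]
      shift = ⟦⟧-bindF ρ (vr ∘ suc) var t

  -- The greedy process starts from one representing constant per class, be it normal or not.
  constAssignment : Assignment
  constAssignment = record
    { ρ        = const ∘ repr
    ; ρ-cong   = cong const ∘ repr-cong
    ; ρ-inj    = λ {k} {l} eq → ~trans (~sym (repr-≈ k)) (~trans (const≡⇒≈ eq) (repr-≈ l))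
    ; ρ-↔*     = λ k → ~⇒↔* const (λ _ → ε) var (repr-≈ k)
    ; ρ-unfold = λ k → symbol (repr k) , empty (symbol-arity (repr k)) ,
                   ~trans (~con (repr k) _) (repr-≈ k) , sym (op≡const refl _) ,
                   λ i → contradiction i (¬Fin0 (symbol-arity (repr k)))
    ; ρ-height = λ k → subst (_≤ _) (sym (heightArgs-empty (symbol-arity (repr k)))) z≤n
    ; ρ-ground = const-⟨⟩ ∘ repr
    }
    where
    heightArgs-empty : ∀ {n} (p : n ≡ 0) → heightArgs {F} (empty p) ≡ 0
    heightArgs-empty refl = refl

  -- Assigning a normal form to one more class

  module Extend (A : Assignment) (k : Const) (¬nf : ¬ Normal (Assignment.ρ A k))
                (f : Symbol F) (ks : Vec Const (arity F f))
                (f~k : app {V = Variable} f (Vec.map con ks) ~ at (con k))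
                (f-nf : Normal (op f (Vec.map (Assignment.ρ A) ks))) where

    open Assignment A

    N : Term F
    N = op f (Vec.map ρ ks)

    ρ′ : Const → Term F
    ρ′ l with l ≈? k
    ... | yes _ = N
    ... | no  _ = ρ l

    ρ′-new : ∀ {l} → l ≈ k → ρ′ l ≡ N
    ρ′-new {l} l≈k with l ≈? k
    ... | yes _  = refl
    ... | no l≉k = contradiction l≈k l≉k

    ρ′-old : ∀ {l} → ¬ l ≈ k → ρ′ l ≡ ρ l
    ρ′-old {l} l≉k with l ≈? k
    ... | yes l≈k = contradiction l≈k l≉k
    ... | no _    = refl

    -- The class of `k` had no normal value, so a constant with a normal value lies outside it.
    ρ′-normal : ∀ {l} → Normal (ρ l) → ρ′ l ≡ ρ l
    ρ′-normal nf = ρ′-old λ l≈k → ¬nf (subst Normal (ρ-cong l≈k) nf)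

    map-ρ′ : ∀ {n} (ls : Vec Const n) → (∀ i → Normal (ρ (lookup ls i))) → Vec.map ρ′ ls ≡ Vec.map ρ ls
    map-ρ′ ls nf = vec-ext λ i →
      trans (Vec.lookup-map i ρ′ ls) (trans (ρ′-normal (nf i)) (sym (Vec.lookup-map i ρ ls)))

    lookup-normal : ∀ i → Normal (ρ (lookup ks i))
    lookup-normal i = subst Normal (Vec.lookup-map i ρ ks) (normal-arg f-nf i)

    map-ρ-inj : ∀ {g} (ls ms : Vec Const (arity F g)) → Vec.map ρ ls ≡ Vec.map ρ ms →
                app {V = Variable} g (Vec.map con ls) ~ app g (Vec.map con ms)
    map-ρ-inj ls ms eq = ~cong λ i → subst₂ (λ a b → at a ~ at b)
      (sym (Vec.lookup-map i con ls)) (sym (Vec.lookup-map i con ms))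
      (ρ-inj (trans (sym (Vec.lookup-map i ρ ls)) (trans (cong (λ v → lookup v i) eq) (Vec.lookup-map i ρ ms))))

    -- Unfolding `ρ l` gives the same symbol with arguments of equal values; these are equivalent as
    -- `ρ` separates classes, and congruence joins the two flat terms.
    N≡ρ⇒≈ : ∀ {l} → N ≡ ρ l → k ≈ l
    N≡ρ⇒≈ {l} N≡ with g , ls , g~l , ρl≡ , _ ← ρ-unfold l with op-injective (trans N≡ ρl≡)
    ... | refl , eq = ~trans (~sym f~k) (~trans (map-ρ-inj ks ls eq) g~l)

    N↔*k : R ⊢ N ↔* ρ k
    N↔*k = subst (λ ts → R ⊢ op f ts ↔* ρ k) (sym (Vec.map-∘ (ev ρ var) con ks)) (~⇒↔* ρ ρ-↔* var f~k)

    more : normals ρ < normals ρ′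
    more = length-filter-strict (λ l → normal? (ρ l)) (λ l → normal? (ρ′ l))
      (λ nf → subst Normal (sym (ρ′-normal nf)) nf) (∈-allFin k) ¬nf (subst Normal (sym (ρ′-new ~refl)) f-nf)

    -- If `f` has arguments, their values are normal, so `normals ρ` is positive and exceeds their
    -- height bound by one; a constant has height 0. By `more`, the bound for `ρ′` has room for
    -- this.
    height-N : height N ≤ normals ρ
    height-N = go (Vec.map ρ ks)
      (λ i → subst (λ t → height t ≤ normals ρ ∸ 1) (sym (Vec.lookup-map i ρ ks)) (ρ-height _)) pos
      where
      pos : Fin (arity F f) → 0 < normals ρ
      pos i = nonempty (∈-filter⁺ (λ k → normal? (ρ k)) (∈-allFin (lookup ks i)) (lookup-normal i))
        where
        nonempty : {A : Set} {x : A} {xs : List A} → x ∈ xs → 0 < length xs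
        nonempty (here _)  = s≤s z≤n
        nonempty (there _) = s≤s z≤n
      go : ∀ {n d} (ts : Vec (Term F) n) → (∀ i → height (lookup ts i) ≤ d ∸ 1) → (Fin n → 0 < d) →
           heightArgs ts ≤ d
      go []                 h≤ 0<d = z≤n
      go {d = zero}  (t ∷ ts) h≤ 0<d = contradiction (0<d zero) λ ()
      go {d = suc d} (t ∷ ts) h≤ 0<d = heightArgs-≤ (t ∷ ts) h≤

    ρ′-elim : ∀ (P : Const → Term F → Set) → (∀ {l} → l ≈ k → P l N) → (∀ {l} → ¬ l ≈ k → P l (ρ l)) →
              ∀ l → P l (ρ′ l)
    ρ′-elim P new old l with l ≈? k
    ... | yes l≈k = new l≈k
    ... | no l≉k  = old l≉k

    extended : Assignment
    extended = record
      { ρ        = ρ′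
      ; ρ-cong   = cong′
      ; ρ-inj    = inj′
      ; ρ-↔*     = ρ′-elim (λ l t → R ⊢ t ↔* const l)
                     (λ {l} l≈k → N↔*k ◅◅ subst (λ t → R ⊢ t ↔* const l) (ρ-cong l≈k) (ρ-↔* l)) (λ _ → ρ-↔* _)
      ; ρ-unfold = ρ′-elim (Unfolding ρ′)
                     (λ l≈k → f , ks , ~trans f~k (~sym l≈k) , unfolded ks lookup-normal)
                     (λ _ → old-unfold)
      ; ρ-height = ρ′-elim (λ l t → height t ≤ normals ρ′ ∸ 1) (λ _ → ℕ.≤-trans height-N (ℕ.∸-monoˡ-≤ 1 more))
                     (λ _ → ℕ.≤-trans (ρ-height _) (ℕ.∸-monoˡ-≤ 1 (ℕ.<⇒≤ more)))
      ; ρ-ground = ρ′-elim (λ l t → ∀ σ → t ⟨ σ ⟩ ≡ t)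
                     (λ _ σ → cong (op f) (trans (⟨⟩*-map (Vec.map ρ ks) σ)
                       (trans (sym (Vec.map-∘ _ _ ks)) (Vec.map-cong (λ l → ρ-ground l σ) ks))))
                     (λ _ → ρ-ground _)
      }
      where
      cong′ : ∀ {l m} → l ≈ m → ρ′ l ≡ ρ′ m
      cong′ {l} {m} l≈m with l ≈? k | m ≈? k
      ... | yes _   | yes _   = refl
      ... | yes l≈k | no m≉k  = contradiction (~trans (~sym l≈m) l≈k) m≉k
      ... | no l≉k  | yes m≈k = contradiction (~trans l≈m m≈k) l≉k
      ... | no _    | no _    = ρ-cong l≈m
      inj′ : ∀ {l m} → ρ′ l ≡ ρ′ m → l ≈ m
      inj′ {l} {m} eq with l ≈? k | m ≈? k
      ... | yes l≈k | yes m≈k = ~trans l≈k (~sym m≈k)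
      ... | yes l≈k | no _    = ~trans l≈k (N≡ρ⇒≈ eq)
      ... | no _    | yes m≈k = ~trans (~sym (N≡ρ⇒≈ (sym eq))) (~sym m≈k)
      ... | no _    | no _    = ρ-inj eq
      -- Unfoldings persist because their arguments have normal values, which `ρ′` keeps.
      unfolded : ∀ {g} (ls : Vec Const (arity F g)) → (∀ i → Normal (ρ (lookup ls i))) →
                 op g (Vec.map ρ ls) ≡ op g (Vec.map ρ′ ls) × (∀ i → Normal (ρ′ (lookup ls i)))
      unfolded ls nf = cong (op _) (sym (map-ρ′ ls nf)) , λ i → subst Normal (sym (ρ′-normal (nf i))) (nf i)
      old-unfold : ∀ {l} → Unfolding ρ′ l (ρ l)
      old-unfold {l} =
        let g , ls , g~l , ρl≡ , nf = ρ-unfold l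
            eq , nf′ = unfolded ls nf
        in g , ls , g~l , trans ρl≡ eq , nf′

  -- Greedy saturation of the assignment

  allConstants : ∀ {n} (as : Vec (Atom Variable) n) →
                 (∃ λ ks → as ≡ Vec.map con ks) ⊎ ∃₂ λ i x → lookup as i ≡ vr x
  allConstants []           = inj₁ ([] , refl)
  allConstants (vr x ∷ as)  = inj₂ (zero , x , refl)
  allConstants (con k ∷ as) with allConstants as
  ... | inj₁ (ks , refl)    = inj₁ (k ∷ ks , refl)
  ... | inj₂ (i , x , eq)   = inj₂ (suc i , x , eq)

  -- The successor leaves room for `at (vr v)` when all symbols are constants.
  maxVars : ℕ
  maxVars = suc (max 0 (List.map (arity F) (allFin (size F))))

  length-varsF : {V : Set} → (t : FTerm V) → length (varsF t) ≤ maxVars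
  length-varsF (at (con k)) = z≤n
  length-varsF (at (vr v))  = s≤s z≤n
  length-varsF (app f as)   = ℕ.≤-trans (length-varsA* as)
    (ℕ.m≤n⇒m≤1+n (All.lookup (xs≤max 0 _) (∈-map⁺ (arity F) (∈-allFin f))))

  -- Twice `maxVars` variables, so that two flat terms can be renamed into the list by one injective
  -- renaming.
  flats : List (FTerm Variable)
  flats = flatTerms (upTo (maxVars + maxVars))

  module _ (A : Assignment) where

    open Assignment A

    ConstantsNormal : Set
    ConstantsNormal = ∀ k {t} → t ∈ flats → t ~ at (con k) → Normal (t [ var ]) → Normal (ρ k)

    FlatsUnique : Set
    FlatsUnique = ∀ {t u} → t ∈ flats → u ∈ flats → t ~ u →
                  Normal (t [ var ]) → Normal (u [ var ]) → t [ var ] ≡ u [ var ]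

  -- Both conditions range over a finite list and can be searched; codings later extend them to flat
  -- terms over any variables.
  record Saturated (A : Assignment) : Set where
    field
      constants-normal : ConstantsNormal A
      flats-unique     : FlatsUnique A

  -- If `t` is a constant atom, the value of `k` would already be normal; a variable in `t` can be
  -- renamed; otherwise all arguments are constants and `t` supplies the new value.
  extend : ∀ A (let open Assignment A) k t → ¬ Normal (ρ k) → t ~ at (con k) → Normal (t [ var ]) →
           BoundedWitness ⊎ ∃ λ A′ → normals ρ < normals (Assignment.ρ A′)
  extend A k (at (con l)) ¬nf l~k nf = contradiction (subst Normal (Assignment.ρ-cong A l~k) nf) ¬nf
  extend A k (at (vr x))  ¬nf x~k nf = inj₁ (Assignment.shiftWitness A (at (vr x)) x~k nf λ ())
  extend A k (app f as)   ¬nf t~k nf with allConstants as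
  ... | inj₁ (ks , refl) = inj₂ (Ext.extended , Ext.more)
    where
    module Ext = Extend A k ¬nf f ks t~k (subst (λ ts → Normal (op f ts)) (sym (Vec.map-∘ _ con ks)) nf)
  ... | inj₂ (i , x , eq) =
    inj₁ (Assignment.shiftWitness A (app f as) t~k nf λ eqs → distinct (proj₂ (op-injective eqs)))
    where
    open Assignment A
    -- Position `i` separates the two instances: it holds `var x` in one and `var (suc x)` in the
    -- other.
    value : ∀ τ → lookup (Vec.map (ev ρ τ) as) i ≡ τ x
    value τ = trans (Vec.lookup-map i _ as) (cong (ev ρ τ) eq)
    distinct : ∀ {eq′ : f ≡ f} → subst (Vec (Term F) ∘ arity F) eq′ (Vec.map (ev ρ var) as) ≢
               Vec.map (ev ρ (var ∘ suc)) as
    distinct {refl} eqs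
      with () ← trans (sym (value var)) (trans (cong (λ v → lookup v i) eqs) (value (var ∘ suc)))

  flats-unique? : ∀ A → BoundedWitness ⊎ FlatsUnique A
  flats-unique? A
    with any? (λ t → any? (λ u → (t ~? u) ×-dec normal? (t [ var ]) ×-dec normal? (u [ var ]) ×-dec
                                 ¬? (t [ var ] ≟T u [ var ])) flats) flats
    where
    open Assignment A
  ... | yes p with t , _ , q ← find p with u , _ , t~u , t-nf , u-nf , t≢u ← find q =
    inj₁ (Assignment.boundedWitness A t u t~u t-nf u-nf t≢u)
  ... | no ¬p = inj₂ unique
    where
    open Assignment A
    unique : FlatsUnique A
    unique {t} {u} t∈ u∈ t~u t-nf u-nf with t [ var ] ≟T u [ var ]
    ... | yes eq = eq
    ... | no neq = contradiction (lose t∈ (lose u∈ (t~u , t-nf , u-nf , neq))) ¬p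

  -- A round without a result raises the number of constants with normal values, which the number of
  -- all constants bounds.
  saturate : BoundedWitness ⊎ ∃ Saturated
  saturate = ascend (normals ∘ Assignment.ρ) (length (constants F)) Assignment.normals≤ step constAssignment
    where
    step : ∀ A → (BoundedWitness ⊎ ∃ Saturated) ⊎ ∃ λ A′ → normals (Assignment.ρ A) < normals (Assignment.ρ A′)
    step A
      with any? (λ k → any? (λ t → ¬? (normal? (ρ k)) ×-dec (t ~? at (con k)) ×-dec
                                   normal? (t [ var ])) flats) (allFin _)
      where
      open Assignment A
    step A | yes p with k , _ , q ← find p with t , _ , ¬nf , t~k , nf ← find q with extend A k t ¬nf t~k nf
    ... | inj₁ w = inj₁ (inj₁ w)
    ... | inj₂ e = inj₂ e
    step A | no ¬p with flats-unique? A
    ... | inj₁ w      = inj₁ (inj₁ w)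
    ... | inj₂ unique = inj₁ (inj₂ (A , record { constants-normal = normal ; flats-unique = unique }))
      where
      open Assignment A
      normal : ConstantsNormal A
      normal k t∈ t~k nf with normal? (ρ k)
      ... | yes ρ-nf = ρ-nf
      ... | no ¬nf   = contradiction (lose (∈-allFin k) (lose t∈ (¬nf , t~k , nf))) ¬p

-- The model

module Model {F : Signature} (R : TRS F) (R-flat : Flat R)
             (A : FlatRewriting.Assignment R R-flat) (S : FlatRewriting.Saturated R R-flat A) where

  open FlatRewriting R R-flat
  open Assignment A
  open Saturated S

  Good : {V : Set} → FTerm V → Set
  Good t = ∃ λ τ → Normal (t [ τ ])

  varsF-rename : {V W : Set} (h : V → W) (t : FTerm V) → varsF (bindF (vr ∘ h) t) ≡ List.map h (varsF t)
  varsF-rename {V} h = go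
    where
    goA : ∀ a → varsA (bindA (vr ∘ h) a) ≡ List.map h (varsA a)
    goA (con k) = refl
    goA (vr v)  = refl
    goA* : ∀ {n} (as : Vec (Atom V) n) → varsA* (Vec.map (bindA (vr ∘ h)) as) ≡ List.map h (varsA* as)
    goA* []       = refl
    goA* (a ∷ as) = trans (cong₂ _++_ (goA a) (goA* as)) (sym (map-++ h (varsA a) (varsA* as)))
    go : ∀ t → varsF (bindF (vr ∘ h) t) ≡ List.map h (varsF t)
    go (at a)     = goA a
    go (app f as) = goA* as

  []-injective : {V : Set} {τ τ′ : V → Term F} (t : FTerm V) → t [ τ ] ≡ t [ τ′ ] →
                 ∀ {v} → v ∈ varsF t → τ v ≡ τ′ v
  []-injective {V} {τ} {τ′} = go
    where
    goA : ∀ a → ev ρ τ a ≡ ev ρ τ′ a → ∀ {v} → v ∈ varsA a → τ v ≡ τ′ v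
    goA (vr v) eq (here refl) = eq
    goA* : ∀ {n} (as : Vec (Atom V) n) → Vec.map (ev ρ τ) as ≡ Vec.map (ev ρ τ′) as →
           ∀ {v} → v ∈ varsA* as → τ v ≡ τ′ v
    goA* (a ∷ as) eq v∈ = [ goA a (Vec.∷-injectiveˡ eq) , goA* as (Vec.∷-injectiveʳ eq) ]′ (∈-++⁻ (varsA a) v∈)
    go : ∀ t → t [ τ ] ≡ t [ τ′ ] → ∀ {v} → v ∈ varsF t → τ v ≡ τ′ v
    go (at a)     eq = goA a eq
    go (app f as) eq = goA* as (args eq)
      where
      args : ∀ {us ws : Vec (Term F) (arity F f)} → _≡_ {A = Term F} (op f us) (op f ws) → us ≡ ws
      args refl = refl

  -- Constants of one class share their value, so a value can determine a flat term only up to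
  -- representatives.
  canonA : {V : Set} → Atom V → Atom V
  canonA (con k) = con (repr k)
  canonA (vr v)  = vr v

  canonF : {V : Set} → FTerm V → FTerm V
  canonF (at a)     = at (canonA a)
  canonF (app f as) = app f (Vec.map canonA as)

  bindF-canonF : {V W : Set} (h : V → W) (t : FTerm V) → bindF (vr ∘ h) (canonF t) ≡ canonF (bindF (vr ∘ h) t)
  bindF-canonF h = go
    where
    goA : ∀ a → bindA (vr ∘ h) (canonA a) ≡ canonA (bindA (vr ∘ h) a)
    goA (con k) = refl
    goA (vr v)  = refl
    go : ∀ t → bindF (vr ∘ h) (canonF t) ≡ canonF (bindF (vr ∘ h) t)
    go (at a)     = cong at (goA a)
    go (app f as) = cong (app f)
      (trans (sym (Vec.map-∘ _ _ as)) (trans (Vec.map-cong goA as) (Vec.map-∘ _ _ as)))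

  []-canonF : {V : Set} (τ : V → Term F) (t : FTerm V) → canonF t [ τ ] ≡ t [ τ ]
  []-canonF τ = go
    where
    goA : ∀ a → ev ρ τ (canonA a) ≡ ev ρ τ a
    goA (con k) = ρ-cong (repr-≈ k)
    goA (vr v)  = refl
    go : ∀ t → canonF t [ τ ] ≡ t [ τ ]
    go (at a)     = goA a
    go (app f as) = cong (op f) (trans (sym (Vec.map-∘ _ _ as)) (Vec.map-cong goA as))

  -- By unfolding, values of constants are never variables; equal ones come from one class.
  ev-canonA : ∀ a b → ev ρ var a ≡ ev ρ var b → canonA a ≡ canonA b
  ev-canonA (con k) (con l) eq = cong con (repr-cong (ρ-inj eq))
  ev-canonA (vr x)  (vr .x) refl = refl
  ev-canonA (con k) (vr x)  eq with _ , _ , _ , ρk≡ , _ ← ρ-unfold k with () ← trans (sym eq) ρk≡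
  ev-canonA (vr x)  (con l) eq with _ , _ , _ , ρl≡ , _ ← ρ-unfold l with () ← trans eq ρl≡

  -- Only for applications, since `at (con k)` may share its value with an application.
  []-canonF-injective : ∀ f as g bs → app f as [ var ] ≡ app g bs [ var ] →
                        canonF (app f as) ≡ canonF (app g bs)
  []-canonF-injective f as g bs eq with op-injective eq
  ... | refl , eqs = cong (app f) (go as bs eqs)
    where
    go : ∀ {n} (as bs : Vec (Atom Variable) n) → Vec.map (ev ρ var) as ≡ Vec.map (ev ρ var) bs →
         Vec.map canonA as ≡ Vec.map canonA bs
    go []       []       _  = refl
    go (a ∷ as) (b ∷ bs) eq = cong₂ _∷_ (ev-canonA a b (Vec.∷-injectiveˡ eq)) (go as bs (Vec.∷-injectiveʳ eq))

  -- Transfer of the finite checks to arbitrary variables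

  module Coding {V : Set} (_≟V_ : DecidableEquality V) (v₀ : V) where

    position : List V → V → ℕ
    position []       v = 0
    position (w ∷ ws) v with v ≟V w
    ... | yes _ = 0
    ... | no  _ = suc (position ws v)

    element : List V → ℕ → V
    element []       n       = v₀
    element (w ∷ ws) zero    = w
    element (w ∷ ws) (suc n) = element ws n

    element-position : ∀ {v vs} → v ∈ vs → element vs (position vs v) ≡ v
    element-position {v} {w ∷ ws} v∈ with v ≟V w
    element-position v∈         | yes refl = refl
    element-position (here eq)  | no v≢w   = contradiction eq v≢w
    element-position (there v∈) | no _     = element-position v∈

    position-< : ∀ {v vs} → v ∈ vs → position vs v < length vs
    position-< {v} {w ∷ ws} v∈ with v ≟V w
    position-< v∈         | yes _  = s≤s z≤n
    position-< (here eq)  | no v≢w = contradiction eq v≢w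
    position-< (there v∈) | no _   = s≤s (position-< v∈)

    module Code (vs : List V) (few : length vs ≤ maxVars + maxVars) where

      code : FTerm V → FTerm Variable
      code = bindF (vr ∘ position vs)

      decode : FTerm Variable → FTerm V
      decode = bindF (vr ∘ element vs)

      module _ (t : FTerm V) (⊆vs : ∀ {v} → v ∈ varsF t → v ∈ vs) where

        decode-code : decode (code t) ≡ t
        decode-code = trans (bindF-bindF _ _ t) (bindF-id t (cong vr ∘ element-position ∘ ⊆vs))

        code∈flats : code t ∈ flats
        code∈flats = ∈-flatTerms (code t) λ x∈ →
          let v , v∈ , x≡ = ∈-map⁻ (position vs) (subst (_ ∈_) (varsF-rename (position vs) t) x∈)
          in ∈-upTo⁺ (ℕ.≤-trans (ℕ.≤-reflexive (cong suc x≡)) (ℕ.≤-trans (position-< (⊆vs v∈)) few))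

        -- Every instance of `t` is a substitution instance of its code, which is how facts about
        -- `flats` reach `t`.
        code-value : ∀ τ → code t [ var ] ⟨ τ ∘ element vs ⟩ ≡ t [ τ ]
        code-value τ = trans ([]-⟨⟩ var _ (code t))
          (trans (sym (⟦⟧-bindF ρ (vr ∘ element vs) τ (code t))) (cong (_[ τ ]) decode-code))

        code-normal : Good t → Normal (code t [ var ])
        code-normal (τ , nf) = normal-⟨⟩⁻ (τ ∘ element vs) (subst Normal (sym (code-value τ)) nf)

    module _ (t : FTerm V) where

      private
        module C = Code (varsF t) (ℕ.≤-trans (length-varsF t) (ℕ.m≤m+n maxVars maxVars))

      -- Any normal instance of `t` forces its code to be normal, so testing the code suffices.
      good? : Dec (Good t)
      good? = map′ (λ nf → var ∘ position (varsF t) , subst Normal (⟦⟧-bindF ρ (vr ∘ position (varsF t)) var t) nf)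
                   (C.code-normal t id) (normal? (C.code t [ var ]))

      good⇒constant-normal : ∀ {k} → t ~ at (con k) → Good t → Normal (ρ k)
      good⇒constant-normal {k} t~k good =
        constants-normal k (C.code∈flats t id) (~bind (vr ∘ position (varsF t)) t~k) (C.code-normal t id good)

    module _ {t u : FTerm V} (t~u : t ~ u) (t-good : Good t) (u-good : Good u) where

      private
        module C = Code (varsF t ++ varsF u) (ℕ.≤-trans (ℕ.≤-reflexive (length-++ (varsF t)))
          (ℕ.+-mono-≤ (length-varsF t) (length-varsF u)))

        codes≡ : C.code t [ var ] ≡ C.code u [ var ]
        codes≡ = flats-unique (C.code∈flats t ∈-++⁺ˡ) (C.code∈flats u (∈-++⁺ʳ (varsF t)))
          (~bind (vr ∘ position (varsF t ++ varsF u)) t~u)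
          (C.code-normal t ∈-++⁺ˡ t-good) (C.code-normal u (∈-++⁺ʳ (varsF t)) u-good)

      -- Under one common numbering both codes have equal values by `flats-unique`; substitution
      -- yields all other instances.
      good-unique : ∀ τ → t [ τ ] ≡ u [ τ ]
      good-unique τ = trans (sym (C.code-value t ∈-++⁺ˡ τ))
        (trans (cong (_⟨ τ ∘ element (varsF t ++ varsF u) ⟩) codes≡) (C.code-value u (∈-++⁺ʳ (varsF t)) τ))

      -- Equal values determine the coded applications up to representatives, and decoding commutes
      -- with `canonF`.
      good-canonF : (∀ {a} → t ≢ at a) → (∀ {a} → u ≢ at a) → canonF t ≡ canonF u
      good-canonF t≢at u≢at = trans (sym (back t ∈-++⁺ˡ))
        (trans (cong C.decode (canon-codes t u t≢at u≢at codes≡)) (back u (∈-++⁺ʳ (varsF t))))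
        where
        canon-codes : ∀ t u → (∀ {a} → t ≢ at a) → (∀ {a} → u ≢ at a) →
                      C.code t [ var ] ≡ C.code u [ var ] → canonF (C.code t) ≡ canonF (C.code u)
        canon-codes (app f as) (app g bs) _ _ eq = []-canonF-injective f _ g _ eq
        canon-codes (at a) _ t≢at _ _ = contradiction refl t≢at
        canon-codes (app _ _) (at a) _ u≢at _ = contradiction refl u≢at
        back : ∀ s → (∀ {v} → v ∈ varsF s → v ∈ varsF t ++ varsF u) → C.decode (canonF (C.code s)) ≡ canonF s
        back s ⊆vs = trans (bindF-canonF _ (C.code s)) (cong canonF (C.decode-code s ⊆vs))

  -- A variable v of u absent from t could be replaced by a fresh one without
  -- leaving the class of t, against uniqueness; Maybe V supplies the fresh one.
  good-vars : {V : Set} (_≟V_ : DecidableEquality V) {t u : FTerm V} → t ~ u → Good u →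
              ∀ {v} → v ∈ varsF u → v ∈ varsF t
  good-vars {V} _≟V_ {t} {u} t~u (τ , nf) {v} v∈u with v ∈? varsF t
    where
    open import Data.List.Membership.DecPropositional _≟V_ using (_∈?_)
  ... | yes v∈t = v∈t
  ... | no v∉t  = contradiction distinct λ ()
    where
    fresh : V → Maybe V
    fresh w with w ≟V v
    ... | yes _ = nothing
    ... | no  _ = just w

    fresh-t : ∀ {w} → w ∈ varsF t → vr (fresh w) ≡ vr (just w)
    fresh-t {w} w∈ with w ≟V v
    ... | yes refl = contradiction w∈ v∉t
    ... | no _     = refl

    fresh-v : fresh v ≡ nothing
    fresh-v with v ≟V v
    ... | yes _  = refl
    ... | no v≢v = contradiction refl v≢v

    -- `nothing` receives the value of `v`, so both renamed copies of `u` have the normal instance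
    -- `u [ τ ]`.
    τ′ : Maybe V → Term F
    τ′ = maybe′ τ (τ v)

    τ′-fresh : ∀ w → τ′ (fresh w) ≡ τ w
    τ′-fresh w with w ≟V v
    ... | yes refl = refl
    ... | no _     = refl

    []-cong : ∀ {τ τ′ : V → Term F} → (∀ w → τ w ≡ τ′ w) → ∀ u → u [ τ ] ≡ u [ τ′ ]
    []-cong {τ} {τ′} eq = go
      where
      goA : ∀ a → ev ρ τ a ≡ ev ρ τ′ a
      goA (con k) = refl
      goA (vr w)  = eq w
      go : ∀ u → u [ τ ] ≡ u [ τ′ ]
      go (at a)     = goA a
      go (app f as) = cong (op f) (Vec.map-cong goA as)

    u~u : bindF (vr ∘ just) u ~ bindF (vr ∘ fresh) u
    u~u = ~trans (~sym (~bind (vr ∘ just) t~u))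
      (subst (_~ bindF (vr ∘ fresh) u) (bindF-cong t fresh-t) (~bind (vr ∘ fresh) t~u))

    -- This valuation tells the fresh variable from all others.
    ξ : Maybe V → Term F
    ξ = maybe′ (λ _ → var 1) (var 0)

    values : bindF (vr ∘ just) u [ ξ ] ≡ bindF (vr ∘ fresh) u [ ξ ]
    values = Coding.good-unique (Maybe.≡-dec _≟V_) nothing u~u
      (τ′ , subst Normal (sym (⟦⟧-bindF ρ (vr ∘ just) τ′ u)) nf)
      (τ′ , subst Normal (sym (trans (⟦⟧-bindF ρ (vr ∘ fresh) τ′ u) ([]-cong τ′-fresh u))) nf) ξ

    distinct : var {F} 1 ≡ var 0
    distinct = trans
      ([]-injective u (trans (sym (⟦⟧-bindF ρ (vr ∘ just) ξ u)) (trans values (⟦⟧-bindF ρ (vr ∘ fresh) ξ u))) v∈u)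
      (cong ξ fresh-v)

  -- Carrier and operations of the model

  D : Set
  D = Term F

  open Decide {V = D} _≟T_ (var 0) using () renaming (_~?_ to _~?ᴰ_)
  module CodingD = Coding {V = D} _≟T_ (var 0)

  #constants : ℕ
  #constants = length (constants F)

  -- Elements of D are terms whose first variables stand for the constants;
  -- the next one is the junk value ⊥ᴰ and the remaining ones are variables.
  leaf : Variable → Const ⊎ ℕ
  leaf x with x ℕ.<? #constants
  ... | yes x< = inj₁ (fromℕ< x<)
  ... | no  _  = inj₂ (x ∸ #constants)

  leaf-const : ∀ k → leaf (toℕ k) ≡ inj₁ k
  leaf-const k with toℕ k ℕ.<? #constants
  ... | yes k< = cong inj₁ (fromℕ<-toℕ k k<)
  ... | no k≮  = contradiction (toℕ<n k) k≮

  leaf-other : ∀ n → leaf (#constants + n) ≡ inj₂ n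
  leaf-other n with (#constants + n) ℕ.<? #constants
  ... | yes lt = contradiction lt (ℕ.m+n≮m #constants n)
  ... | no _   = cong inj₂ (ℕ.m+n∸m≡n #constants n)

  ⊥ᴰ : D
  ⊥ᴰ = var (#constants + 0)

  -- An element that codes no constant serves as its own variable, so arguments in the model form
  -- flat terms over `D`.
  α : D → Atom D
  α (var x) = [ con , (λ _ → vr (var x)) ]′ (leaf x)
  α (op f ds) = vr (op f ds)

  reifyA : Atom D → D
  reifyA (con k) = var (toℕ k)
  reifyA (vr d)  = d

  reify : FTerm D → D
  reify (at a)     = reifyA a
  reify (app f as) = op f (Vec.map reifyA as)

  reifyA-α : ∀ d → reifyA (α d) ≡ d
  reifyA-α (op f ds) = refl
  reifyA-α (var x) with x ℕ.<? #constants
  ... | yes x< = cong var (toℕ-fromℕ< x<)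
  ... | no _   = refl

  -- A variable produced by `α` never codes a constant, unlike an arbitrary `vr e`.
  α-vr : ∀ {d e} → α d ≡ vr e → α e ≡ vr e
  α-vr {d} {e} eq = trans (cong α (trans (cong reifyA (sym eq)) (reifyA-α d))) eq

  α-const : ∀ k → α (var (toℕ k)) ≡ con k
  α-const k = cong [ con , _ ]′ (leaf-const k)

  α-other : ∀ n → α (var (#constants + n)) ≡ vr (var (#constants + n))
  α-other n = cong [ con , _ ]′ (leaf-other n)

  -- `pred` undoes the `suc` by which `eval` leaves a place for `⊥ᴰ`; the latter is read as `var 0`,
  -- an arbitrary default.
  θ : Substitution F
  θ x = [ ρ , var ∘ pred ]′ (leaf x)

  readback : D → Term F
  readback d = d ⟨ θ ⟩

  readback-α : ∀ d → ev ρ readback (α d) ≡ readback d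
  readback-α (op f ds) = refl
  readback-α (var x) with x ℕ.<? #constants in eq
  ... | yes _ = refl
  ... | no  _ rewrite eq = refl

  readback-reify : ∀ t → readback (reify t) ≡ t [ readback ]
  readback-reify = go
    where
    goA : ∀ a → readback (reifyA a) ≡ ev ρ readback a
    goA (con k) = cong [ ρ , var ∘ pred ]′ (leaf-const k)
    goA (vr d)  = refl
    go : ∀ t → readback (reify t) ≡ t [ readback ]
    go (at a)     = goA a
    go (app f as) = cong (op f) (trans (⟨⟩*-map (Vec.map reifyA as) θ)
      (trans (sym (Vec.map-∘ _ _ as)) (Vec.map-cong goA as)))

  NonAtomic : FTerm D → Set
  NonAtomic t = ∀ {a} → ¬ (t ~ at a)

  -- A relation instead of a function makes invariance under `_~_` immediate; determinacy and
  -- existence follow separately.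
  data Value (t : FTerm D) : D → Set where
    viaAtom : ∀ a → t ~ at a → Value t (reify (canonF (at a)))
    viaGood : NonAtomic t → ∀ u → t ~ u → Good u → Value t (reify (canonF u))
    none    : NonAtomic t → (∀ {u} → t ~ u → ¬ Good u) → Value t ⊥ᴰ

  value-~ : ∀ {t u d} → t ~ u → Value t d → Value u d
  value-~ t~u (viaAtom a t~a)          = viaAtom a (~trans (~sym t~u) t~a)
  value-~ t~u (viaGood na s t~s good)  = viaGood (na ∘ ~trans t~u) s (~trans (~sym t~u) t~s) good
  value-~ t~u (none na bad)            = none (na ∘ ~trans t~u) (bad ∘ ~trans t~u)

  vr-good : ∀ (d : D) → Good (at (vr d))
  vr-good d = (λ _ → var 0) , var-normal

  -- A variable is good, so by `good-vars` it must occur on the other side as well.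
  ~⇒canonA : ∀ {a b : Atom D} → at a ~ at b → canonA a ≡ canonA b
  -- Renaming to `vr 0` leads from variables in `D` to the numerical ones over which `_≈_` is
  -- defined.
  ~⇒canonA {con k} {con l} k~l = cong con (repr-cong (~bind (λ _ → vr 0) k~l))
  ~⇒canonA {con k} {vr e}  k~e with () ← good-vars {D} _≟T_ k~e (vr-good e) (here refl)
  ~⇒canonA {vr d}  {con l} d~l with () ← good-vars {D} _≟T_ (~sym d~l) (vr-good d) (here refl)
  ~⇒canonA {vr d}  {vr e}  d~e with here refl ← good-vars {D} _≟T_ d~e (vr-good e) (here refl) = refl

  -- The three cases exclude each other. Good terms of a nonatomic class are applications, hence
  -- equal up to representatives.
  value-unique : ∀ {t d e} → Value t d → Value t e → d ≡ e
  value-unique (viaAtom a t~a)  (viaAtom b t~b)  = cong reifyA (~⇒canonA (~trans (~sym t~a) t~b))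
  value-unique (viaAtom a t~a)  (viaGood na _ _ _) = contradiction t~a na
  value-unique (viaAtom a t~a)  (none na _)      = contradiction t~a na
  value-unique (viaGood na _ _ _) (viaAtom b t~b)  = contradiction t~b na
  value-unique (viaGood na u t~u u-good) (viaGood _ s t~s s-good) =
    cong reify (CodingD.good-canonF (~trans (~sym t~u) t~s) u-good s-good
      (λ { refl → na t~u }) (λ { refl → na t~s }))
  value-unique (viaGood _ u t~u good) (none _ bad) = contradiction good (bad t~u)
  value-unique (none na _) (viaAtom b t~b)       = contradiction t~b na
  value-unique (none _ bad) (viaGood _ u t~u good) = contradiction good (bad t~u)
  value-unique (none _ _) (none _ _)             = refl

  atom-vars : ∀ {t} (a : Atom D) → t ~ at a → ∀ {v} → v ∈ varsA a → v ∈ varsF t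
  atom-vars (vr d) t~d = good-vars {D} _≟T_ t~d (vr-good d)

  -- Atoms and good terms in the class have no variables beyond those of `t`, so the finite searches
  -- are exhaustive.
  value : ∀ (t : FTerm D) → ∃ (Value t)
  value t with any? (λ a → t ~?ᴰ at a) (atoms (varsF t))
  ... | yes p with a , _ , t~a ← find p = _ , viaAtom a t~a
  ... | no ¬p = nonAtomicValue λ {a} t~a → ¬p (lose (∈-atoms a (atom-vars a t~a)) t~a)
    where
    nonAtomicValue : NonAtomic t → ∃ (Value t)
    nonAtomicValue na with any? (λ u → (t ~?ᴰ u) ×-dec CodingD.good? u) (flatTerms (varsF t))
    ... | yes q with u , _ , t~u , good ← find q = _ , viaGood na u t~u good
    ... | no ¬q = _ , none na λ {u} t~u good →
        ¬q (lose (∈-flatTerms u (good-vars {D} _≟T_ t~u good)) (t~u , good))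

  apply : ∀ f → Vec D (arity F f) → D
  apply f ds = proj₁ (value (app f (Vec.map α ds)))

  -- Evaluation, its soundness and readback

  eval  : Term F → D
  eval* : ∀ {n} → Vec (Term F) n → Vec D n
  eval (var x)   = var (#constants + suc x)
  eval (op f ts) = apply f (eval* ts)
  eval* []       = []
  eval* (t ∷ ts) = eval t ∷ eval* ts

  lookup-eval* : ∀ {n} (ts : Vec (Term F) n) i → lookup (eval* ts) i ≡ eval (lookup ts i)
  lookup-eval* (t ∷ ts) zero    = refl
  lookup-eval* (t ∷ ts) (suc i) = lookup-eval* ts i

  eval*-update : ∀ {n} (ts : Vec (Term F) n) i {u} → eval (lookup ts i) ≡ eval u →
                 eval* ts ≡ eval* (ts [ i ]≔ u)
  eval*-update (t ∷ ts) zero    eq = cong (_∷ _) eq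
  eval*-update (t ∷ ts) (suc i) eq = cong (_ ∷_) (eval*-update ts i eq)

  value-apply : ∀ f ts → Value (app f (Vec.map α (eval* ts))) (eval (op f ts))
  value-apply f ts = proj₂ (value (app f (Vec.map α (eval* ts))))

  -- For a rule with a variable as right side, the value of `at (α d)` must be `d` itself. This
  -- excludes codes of constants other than representatives.
  Canonical : D → Set
  Canonical d = canonA (α d) ≡ α d

  vars-α : ∀ {n} (ds : Vec D n) {e} → e ∈ varsA* (Vec.map α ds) → α e ≡ vr e
  vars-α (d ∷ ds) e∈ with ∈-++⁻ (varsA (α d)) e∈
  ... | inj₂ e∈ds = vars-α ds e∈ds
  ... | inj₁ e∈d with α d in eq
  vars-α (d ∷ ds) e∈ | inj₁ (here refl) | vr _ = α-vr {d} eq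

  value-canonical : ∀ {f} ds {d} → Value (app f (Vec.map α ds)) d → Canonical d
  value-canonical ds (viaAtom (con k) _) rewrite α-const (repr k) = cong con (repr-cong (repr-≈ k))
  -- By `good-vars`, `d` occurs among the arguments, so it codes no constant.
  value-canonical ds (viaAtom (vr d) t~d)
    rewrite vars-α ds (good-vars {D} _≟T_ t~d (vr-good d) (here refl)) = refl
  value-canonical ds (viaGood na (at a) t~a _) = contradiction t~a na
  value-canonical ds (viaGood na (app g bs) _ _) = refl
  value-canonical ds (none _ _) rewrite α-other 0 = refl

  eval-canonical : ∀ t → Canonical (eval t)
  eval-canonical (var x) rewrite α-other (suc x) = refl
  eval-canonical (op f ts) = value-canonical (eval* ts) (value-apply f ts)

  eval-const : ∀ k → eval (const k) ≡ var (toℕ (repr k))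
  eval-const k = value-unique (value-apply (symbol k) _) (viaAtom (con k) (~con k _))

  module _ (σ : Substitution F) where

    valuation : Variable → Atom D
    valuation = α ∘ eval ∘ σ

    -- Equivalent rather than equal: a constant evaluates to the code of its representative.
    eval-toAtom : ∀ t → height t ≤ 0 → at (α (eval (t ⟨ σ ⟩))) ~ at (bindA valuation (toAtom t))
    eval-toAtom (var x)   h = ~refl
    eval-toAtom (op f ts) h with k , eq , t≡k ← toAtom-const f ts h =
      subst₂ (λ d a → at (α d) ~ at (bindA valuation a))
        (sym (trans (cong eval (trans (cong (_⟨ σ ⟩) t≡k) (const-⟨⟩ k σ))) (eval-const k))) (sym eq)
        (subst (λ a → at a ~ at (con k)) (sym (α-const (repr k))) (~bind (λ _ → vr (var 0)) (repr-≈ k)))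

    -- Only the values of the substituted terms matter, and they act as atoms over `D`; thus `~rule`
    -- covers arbitrary rule instances.
    value-flat : ∀ t → FlatTerm t → Value (bindF valuation (flatten t)) (eval (t ⟨ σ ⟩))
    value-flat (var x)   h = subst (Value _) (trans (cong reifyA (eval-canonical (σ x))) (reifyA-α (eval (σ x))))
      (viaAtom (valuation x) ~refl)
    value-flat (op f ts) h = value-~ (~cong λ i → subst₂ (λ a b → at a ~ at b)
        (sym (trans (Vec.lookup-map i α (eval* (ts ⟨ σ ⟩*)))
          (cong α (trans (lookup-eval* (ts ⟨ σ ⟩*) i) (cong eval (lookup-⟨⟩* ts σ i))))))
        (sym (trans (Vec.lookup-map i (bindA valuation) (Vec.map toAtom ts))
          (cong (bindA valuation) (Vec.lookup-map i toAtom ts))))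
        (eval-toAtom (lookup ts i) (height-arg ts h i)))
      (value-apply f (ts ⟨ σ ⟩*))

  -- At the root, `~rule` links the flat terms of both sides, and equivalent flat terms have the
  -- same value.
  eval-⟶ : ∀ {t u} → R ⊢ t ⟶ u → eval t ≡ eval u
  eval-⟶ (root {ρ} ρ∈R σ) with l-flat , r-flat ← All.lookup R-flat ρ∈R =
    value-unique (value-~ (~rule ρ∈R (valuation σ)) (value-flat σ (lhs ρ) l-flat)) (value-flat σ (rhs ρ) r-flat)
  eval-⟶ (arg {f} ts i t⟶u) = cong (apply f) (eval*-update ts i (eval-⟶ t⟶u))

  eval-↔* : ∀ {t u} → R ⊢ t ↔* u → eval t ≡ eval u
  eval-↔* ε              = refl
  eval-↔* (fwd s ◅ rest) = trans (eval-⟶ s) (eval-↔* rest)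
  eval-↔* (bwd s ◅ rest) = trans (sym (eval-⟶ s)) (eval-↔* rest)

  -- Here `t` itself is good, which excludes junk, and the chosen member of the class is read back
  -- alike by `good-unique`. If it is a constant, `constants-normal` makes it good.
  value-readback : ∀ {t d} → Value t d → Normal (t [ readback ]) → readback d ≡ t [ readback ]
  value-readback {t} v nf = go v
    where
    good : Good t
    good = readback , nf
    via : ∀ u → t ~ u → Good u → readback (reify (canonF u)) ≡ t [ readback ]
    via u t~u u-good = trans (readback-reify (canonF u)) (trans ([]-canonF readback u)
      (sym (CodingD.good-unique t~u good u-good readback)))
    go : ∀ {d} → Value t d → readback d ≡ t [ readback ]
    go (viaAtom (con k) t~k) = via (at (con k)) t~k (readback , CodingD.good⇒constant-normal t t~k good)
    go (viaAtom (vr d) t~d)  = via (at (vr d)) t~d (vr-good d)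
    go (viaGood _ u t~u u-good) = via u t~u u-good
    go (none _ bad) = contradiction good (bad ~refl)

  -- The arguments are normal and recovered by induction, and `value-readback` restores the head
  -- symbol. So `eval` is injective on normal forms.
  readback-eval  : ∀ t → Normal t → readback (eval t) ≡ t
  readback-eval* : ∀ {n} (ts : Vec (Term F) n) → (∀ i → Normal (lookup ts i)) → eval* ts ⟨ θ ⟩* ≡ ts
  readback-eval (var x) nf = cong [ ρ , var ∘ pred ]′ (leaf-other (suc x))
  readback-eval (op f ts) nf = trans (value-readback (value-apply f ts) (subst Normal (sym value≡) nf)) value≡
    where
    value≡ : app f (Vec.map α (eval* ts)) [ readback ] ≡ op f ts
    value≡ = cong (op f) (trans (sym (Vec.map-∘ _ _ (eval* ts))) (trans (Vec.map-cong readback-α (eval* ts))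
      (trans (sym (⟨⟩*-map (eval* ts) θ)) (readback-eval* ts (normal-arg nf)))))
  readback-eval* []       nf = refl
  readback-eval* (t ∷ ts) nf = cong₂ _∷_ (readback-eval t (nf zero)) (readback-eval* ts (nf ∘ suc))

  unique : UN⁼ R
  unique (M , N , w) = distinct (trans (sym (readback-eval M normalˡ))
    (trans (cong readback (eval-↔* equivalent)) (readback-eval N normalʳ)))
    where
    open Witness w

theorem3p2 : (∀ {F : Signature} (R : TRS F) → Flat R →
    ∃₂ (λ M N → Witness R M N) →
    ∃₂ (λ N₀ N₁ → Witness R N₀ N₁ × height N₀ ≤ bound F × height N₁ ≤ bound F))
    × (∀ {F : Signature} (R : TRS F) → Flat R → Dec (UN⁼ R))
-- A bounded witness refutes uniqueness, so one dichotomy yields both the height bound and the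
-- decision.
theorem3p2 = (λ R flat w → [ id , (λ un → contradiction w un) ]′ (dichotomy R flat)) ,
             (λ R flat → [ (λ { (M , N , w , _) → no λ un → un (M , N , w) }) , yes ]′ (dichotomy R flat))
  where
  dichotomy : ∀ {F} (R : TRS F) (flat : Flat R) → FlatRewriting.BoundedWitness R flat ⊎ UN⁼ R
  dichotomy R flat with FlatRewriting.saturate R flat
  ... | inj₁ w       = inj₁ w
  ... | inj₂ (A , S) = inj₂ (Model.unique R flat A S)
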